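{- Let $G$ be an essentially 4-connected toroidal triangulation, let $\mathcal B(A(G))$ be the set of all balanced 4-orientations of its angle map $A(G)$, and let $f_0$ be any face of $A(G)$. Then $(\mathcal B(A(G)),\leq_{f_0})$ is a distributive lattice.
   Context: A toroidal map is a finite graph embedded on the (oriented) torus such that all faces are homeomorphic to open disks. Loops and multiple edges are allowed, but throughout embedded graphs have no contractible loop (an edge enclosing a region homeomorphic to an open disk) and no homotopic multiple edges (two edges with the same extremities whose union encloses a region homeomorphic to an open disk). A toroidal triangulation is a toroidal map all of whose faces have size three. A cycle is a closed walk with no repeated vertices (a loop is a cycle of length one); it is contractible if it encloses a region homeomorphic to an open disk. $G$ is essentially 4-connected if its universal cover $G^\infty$ is 4-connected (at least 5 vertices, and connected after removal of any 3 vertices). The angle map $A(G)$ is the bipartite toroidal map whose vertices are the vertices of $G$ (primal-vertices) and one vertex inside each face of $G$ (dual-vertices), with one edge for each angle (corner) of $G$, joining the vertex of the angle to the dual-vertex of the face containing the angle. Each face of $A(G)$ is a quadrangle. A 4-orientation of $A(G)$ is an orientation of its edges in which every primal-vertex has outdegree exactly 4 and every dual-vertex has outdegree exactly 1. Given an orientation of $A(G)$ and a cycle $C$ of $G$ with a direction of traversal, $\gamma(C)$ is the number of edges of $A(G)$ leaving $C$ (outgoing from vertices of $C$) on its right minus the number of edges of $A(G)$ leaving $C$ on its left. A 4-orientation is balanced if every non-contractible cycle $C$ of $G$ satisfies $\gamma(C)=0$. The order: fix an arbitrary reference orientation of the edges of $A(G)$. An oriented subgraph $T$ of $A(G)$ (a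 set of edges, each with a direction) has characteristic flow $\phi(T)\in\mathbb Z^{E(A(G))}$ with coordinate $+1$ on an edge of $T$ directed as in the reference orientation, $-1$ on an edge of $T$ directed oppositely, and $0$ on other edges; the characteristic flow of a walk counts forward minus backward traversals of each edge. Let $\mathcal F$ be the set of counterclockwise facial walks of $A(G)$, $F_0$ the one of $f_0$, and $\mathcal F'=\mathcal F\setminus\{F_0\}$. For two orientations $D,D'$ of $A(G)$, $D\setminus D'$ is the oriented subgraph of $D$ formed by the edges that are not oriented as in $D'$. Set $D\leq_{f_0}D'$ if and only if $\phi(D\setminus D')=\sum_{F\in\mathcal F'}\lambda_F\,\phi(F)$ for some $\lambda\in\mathbb N^{\mathcal F'}$ (non-negative integers). -}

module Defs where

import Algebra.Properties.Monoid.Sum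
open import Data.Bool.Base using (Bool; true; false; not; if_then_else_)
import Data.Bool.Properties as Bool
open import Data.Fin.Base using (Fin)
import Data.Fin.Properties as Fin
open import Data.Integer.Base as ℤ using (ℤ; 0ℤ; _⊖_; +_)
import Data.Integer.Properties as ℤ
open import Data.List.Base using
  (List; []; _∷_; [_]; _++_; length; map; zip; concatMap; filterᵇ; iterate)
open import Data.List.Membership.Propositional using (_∈_)
open import Data.List.Relation.Unary.Unique.Propositional using (Unique)
open import Data.Nat.Base using (ℕ; zero; suc; _+_; _*_)
import Data.Nat.Properties as ℕ
open import Data.Product.Base using (Σ; Σ-syntax; ∃-syntax; _×_; _,_; proj₁; proj₂)
open import Data.Product.Function.NonDependent.Propositional using (_×-↔_)
open import Data.Sum.Base using (_⊎_; inj₁; inj₂)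
open import Data.Sum.Function.Propositional using (_⊎-↔_)
open import Function.Base using (_∘_)
open import Function.Bundles using (_↔_; _⇔_; Inverse; mk↔ₛ′)
open import Function.Construct.Composition using (_↔-∘_)
open import Function.Definitions using (Injective)
open import Function.Properties.Inverse using (↔-sym; Inverse⇒Injection)
open import Level using (0ℓ)
open import Relation.Binary.Bundles using (Setoid)
open import Relation.Binary.Core using (Rel)
open import Relation.Binary.Construct.Closure.Equivalence as EqC using (EqClosure)
open import Relation.Binary.Construct.Closure.ReflexiveTransitive
  using (Star; ε; _◅_; _◅◅_)
open import Relation.Binary.Definitions using (DecidableEquality)
open import Relation.Binary.PropositionalEquality
  using (_≡_; _≢_; refl; sym; trans; cong; subst)
open import Relation.Nullary using (¬_; Dec; does; ¬?)
open import Relation.Nullary.Decidable using (via-injection; _×-dec_)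
open import Relation.Unary using (Pred; Decidable)

indicator : {P : Set} → Dec P → ℕ
indicator P? = if does P? then 1 else 0

module Enumerated {A : Set} {n : ℕ} (enum : Fin n ↔ A) where

  open Algebra.Properties.Monoid.Sum ℕ.+-0-monoid using (sum)
  open Algebra.Properties.Monoid.Sum ℤ.+-0-monoid using () renaming (sum to sumℤ)

  _≟_ : DecidableEquality A
  _≟_ = via-injection (Inverse⇒Injection (↔-sym enum)) Fin._≟_

  count : {P : Pred A 0ℓ} → Decidable P → ℕ
  count P? = sum (λ i → indicator (P? (Inverse.to enum i)))

  ∑ : (A → ℤ) → ℤ
  ∑ f = sumℤ (λ i → f (Inverse.to enum i))

-- Maps on oriented closed surfaces, all of whose faces are open disks,
-- given by their rotation systems.

Orbit : {A : Set} → (A → A) → Rel A 0ℓ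
Orbit f = Star (λ x y → y ≡ f x)

record Map : Set₁ where
  field
    Vertex Edge Face : Set
    #V #E #F         : ℕ
    vertices         : Fin #V ↔ Vertex
    edges            : Fin #E ↔ Edge
    faces            : Fin #F ↔ Face

  -- The two darts (e , true) and (e , false) are the two directions of
  -- traversal of e.
  Dart : Set
  Dart = Edge × Bool

  edge : Dart → Edge
  edge = proj₁

  rev : Dart → Dart
  rev (e , b) = e , not b

  -- The rotation sends a dart to the next dart counterclockwise with the
  -- same tail.
  field
    rotation : Dart ↔ Dart

  open Inverse rotation public using () renaming (to to σ; from to σ⁻¹)

  -- The dart following d on the boundary of the face to the left of d.
  -- Iterating it runs counterclockwise around that face.
  φ : Dart → Dart
  φ d = σ⁻¹ (rev d)

  -- tail d is the origin of d, and left d is the face on its left.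
  -- Vertices are the orbits of σ and faces are the orbits of φ.
  field
    tail             : Dart → Vertex
    tail-surjective  : ∀ v → ∃[ d ] tail d ≡ v
    tail-σ           : ∀ d → tail (σ d) ≡ tail d
    tail-orbit       : ∀ c d → tail c ≡ tail d → Orbit σ c d
    left             : Dart → Face
    left-surjective  : ∀ f → ∃[ d ] left d ≡ f
    left-φ           : ∀ d → left (φ d) ≡ left d
    left-orbit       : ∀ c d → left c ≡ left d → Orbit φ c d

  head : Dart → Vertex
  head = tail ∘ rev

  #D : ℕ
  #D = #E * 2

  darts : Fin #D ↔ Dart
  darts = (edges ×-↔ Fin.2↔Bool) ↔-∘ Fin.*↔×

  module V = Enumerated vertices
  module E = Enumerated edges
  module F = Enumerated faces
  module D = Enumerated darts

  degree : Face → ℕ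
  degree f = D.count (λ d → left d F.≟ f)

module _ (M : Map) where

  open Map M

  record Step (u v : Vertex) : Set where
    constructor step
    field
      dart    : Dart
      tail-eq : tail dart ≡ u
      head-eq : head dart ≡ v

  open Step

  Walk : Rel Vertex 0ℓ
  Walk = Star Step

  walkDarts : ∀ {u v} → Walk u v → List Dart
  walkDarts ε       = []
  walkDarts (s ◅ w) = dart s ∷ walkDarts w

  IsFacialWalk : ∀ {v} → Walk v v → Set
  IsFacialWalk w = ∃[ d ] walkDarts w ≡ iterate φ d (degree (left d))

  data Deletion {u v : Vertex} : Rel (Walk u v) 0ℓ where
    spur : ∀ {x y} (p : Walk u x) (s : Step x y) (t : Step y x) (q : Walk x v) →
           dart t ≡ rev (dart s) →
           Deletion (p ◅◅ s ◅ t ◅ q) (p ◅◅ q)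
    face : ∀ {x} (p : Walk u x) (c : Walk x x) (q : Walk x v) →
           IsFacialWalk c →
           Deletion (p ◅◅ c ◅◅ q) (p ◅◅ q)

  Homotopic : ∀ {u v} → Rel (Walk u v) 0ℓ
  Homotopic = EqClosure Deletion

record Graph : Set₁ where
  field
    vertexSetoid : Setoid 0ℓ 0ℓ
  open Setoid vertexSetoid public using (_≈_; _≉_) renaming (Carrier to Vertex)
  field
    Adjacent : Rel Vertex 0ℓ

record FourConnected (Γ : Graph) : Set where
  open Graph Γ
  field
    fiveVertices : ∃[ f ] Injective {A = Fin 5} _≡_ _≈_ f
    connected    : (x : Fin 3 → Vertex) → Injective _≡_ _≈_ x →
                   let Kept  = λ a → ∀ i → a ≉ x i
                       _∼_   = λ a b → Adjacent a b × Kept b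
                   in ∀ a b → Kept a → Kept b → ∃[ b′ ] Star _∼_ a b′ × b′ ≈ b

module _ (M : Map) where

  open Map M

  -- The 1-skeleton of the universal cover: its vertices are the homotopy
  -- classes of the walks starting at a base vertex.
  universalCover : Vertex → Graph
  universalCover base = record
    { vertexSetoid = record
      { Carrier       = Σ Vertex (Walk M base)
      ; _≈_           = Same
      ; isEquivalence = record { refl = refl , ε ; sym = same-sym ; trans = same-trans }
      }
    ; Adjacent = λ (u , p) (v , q) →
        Σ[ s ∈ Step M u v ] Homotopic M (p ◅◅ s ◅ ε) q
    }
    where
    Same : Rel (Σ Vertex (Walk M base)) 0ℓ
    Same (u , p) (v , q) = Σ[ eq ∈ u ≡ v ] Homotopic M (subst (Walk M base) eq p) q

    same-sym : ∀ {x y} → Same x y → Same y x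
    same-sym (refl , h) = refl , EqC.symmetric (Deletion M) h

    same-trans : ∀ {x y z} → Same x y → Same y z → Same x z
    same-trans (refl , h) (refl , k) = refl , h ◅◅ k

  EssentiallyFourConnected : Set
  EssentiallyFourConnected = ∀ base → FourConnected (universalCover base)

module _ (M : Map) where

  open Map M

  -- A set of faces stands for the open set consisting of these faces, the
  -- edges having both sides in the set, and the vertices having all their
  -- angles in the set.
  module Region (region : Face → Bool) where

    Inside : Pred Face 0ℓ
    Inside f = region f ≡ true

    inside? : Decidable Inside
    inside? f = region f Bool.≟ true

    outsideAngles : Vertex → ℕ
    outsideAngles v = D.count (λ d → (tail d V.≟ v) ×-dec ¬? (inside? (left d)))

    #innerVertices #innerEdges #innerFaces : ℕ
    #innerVertices = V.count (λ v → outsideAngles v ℕ.≟ 0)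
    #innerEdges    = E.count (λ e → inside? (left (e , true)) ×-dec inside? (left (e , false)))
    #innerFaces    = F.count inside?

    AcrossInnerEdge : Rel Face 0ℓ
    AcrossInnerEdge f g = ∃[ d ] left d ≡ f × left (rev d) ≡ g × Inside f × Inside g

  -- An open disk is a connected region with Euler characteristic 1.
  record EnclosesDisk (C : List Edge) : Set where
    field
      region : Face → Bool
    open Region region
    field
      boundary  : ∀ e → e ∈ C ⇔ region (left (e , true)) ≢ region (left (e , false))
      connected : ∀ f g → Inside f → Inside g → Star AcrossInnerEdge f g
      euler     : #innerVertices + #innerFaces ≡ suc #innerEdges

  record IsToroidal : Set where
    field
      nonempty  : Vertex
      connected : ∀ u v → Walk M u v
      euler     : #V + #F ≡ #E

  record IsToroidalTriangulation : Set where
    field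
      isToroidal                : IsToroidal
      noContractibleLoop        : ∀ d → tail d ≡ head d → ¬ EnclosesDisk [ edge d ]
      noHomotopicMultipleEdges  : ∀ c d → edge c ≢ edge d →
                                  tail c ≡ tail d → head c ≡ head d →
                                  ¬ EnclosesDisk (edge c ∷ edge d ∷ [])
      triangular                : ∀ f → degree f ≡ 3

  -- Cycles come with a starting vertex and a direction of traversal.
  -- Without edge-simple, going back and forth along an edge would qualify.
  record Cycle : Set where
    field
      {base}      : Vertex
      walk        : Walk M base base
    cycleDarts : List Dart
    cycleDarts = walkDarts M walk
    field
      nonempty    : cycleDarts ≢ []
      simple      : Unique (map tail cycleDarts)
      edge-simple : Unique (map edge cycleDarts)

  Contractible : Cycle → Set
  Contractible C = EnclosesDisk (map edge (Cycle.cycleDarts C))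

module _ (M : Map) where

  open Map M

  -- The edge e is directed as the dart (e , D e).
  Orientation : Set
  Orientation = Edge → Bool

  directed? : (D : Orientation) → Decidable (λ d → D (edge d) ≡ proj₂ d)
  directed? D (e , b) = D e Bool.≟ b

  outdegree : Orientation → Vertex → ℕ
  outdegree D v = D.count (λ d → (tail d V.≟ v) ×-dec directed? D d)

  -- The characteristic flow, with respect to the reference orientation R,
  -- of a family of directed edges in which each dart has a multiplicity.
  characteristicFlow : Orientation → (Dart → ℕ) → Edge → ℤ
  characteristicFlow R t e = t (e , R e) ⊖ t (e , not (R e))

  -- D ∖ D′, as the indicator function of its darts.
  difference : Orientation → Orientation → Dart → ℕ
  difference D D′ d = indicator (directed? D d ×-dec ¬? (directed? D′ d))

  -- The counterclockwise facial walk of f traverses every dart having f on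
  -- its left once, and no other dart.
  facialWalk : Face → Dart → ℕ
  facialWalk f d = indicator (left d F.≟ f)

  -- Requiring the coefficient of f₀ to vanish amounts to summing over the
  -- faces other than f₀.
  Below : Orientation → Face → Rel Orientation 0ℓ
  Below R f₀ D D′ = Σ[ λ′ ∈ (Face → ℕ) ] λ′ f₀ ≡ 0 × (∀ e →
    characteristicFlow R (difference D D′) e ≡
    F.∑ (λ f → + λ′ f ℤ.* characteristicFlow R (facialWalk f) e))

module _ (M : Map) where

  open Map M

  -- The dart d stands for the angle between d and σ d, which lies at
  -- tail d in the face left d.  The corresponding edge of the angle map has
  -- the dart (d , true) from tail d to left d and the opposite dart
  -- (d , false).  Around the vertex of the angle map dual to a face, the
  -- angles of this face are ordered by φ.  The face of the angle map
  -- containing an edge of M is identified with this edge.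
  angleMap : Map
  angleMap = record
    { Vertex          = Vertex ⊎ Face
    ; Edge            = Dart
    ; Face            = Edge
    ; #V              = #V + #F
    ; #E              = #D
    ; #F              = #E
    ; vertices        = (vertices ⊎-↔ faces) ↔-∘ Fin.+↔⊎
    ; edges           = darts
    ; faces           = edges
    ; rotation        = mk↔ₛ′ σA σA⁻¹ σA-σA⁻¹ σA⁻¹-σA
    ; tail            = tailA
    ; tail-surjective = tailA-surjective
    ; tail-σ          = tailA-σ
    ; tail-orbit      = tailA-orbit
    ; left            = leftA
    ; left-surjective = λ e → ((e , true) , false) , refl
    ; left-φ          = leftA-φ
    ; left-orbit      = λ c d eq → toRep c ◅◅ subst (λ e → Orbit φA (rep e) d) (sym eq) (fromRep d)
    }
    where
    DartA : Set
    DartA = Dart × Bool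

    rev-rev : ∀ d → rev (rev d) ≡ d
    rev-rev (e , b) = cong (e ,_) (Bool.not-involutive b)

    σσ⁻¹ : ∀ d → σ (σ⁻¹ d) ≡ d
    σσ⁻¹ = Inverse.strictlyInverseˡ rotation

    σ⁻¹σ : ∀ d → σ⁻¹ (σ d) ≡ d
    σ⁻¹σ = Inverse.strictlyInverseʳ rotation

    φ⁻¹ : Dart → Dart
    φ⁻¹ d = rev (σ d)

    φφ⁻¹ : ∀ d → φ (φ⁻¹ d) ≡ d
    φφ⁻¹ d = trans (cong σ⁻¹ (rev-rev (σ d))) (σ⁻¹σ d)

    φ⁻¹φ : ∀ d → φ⁻¹ (φ d) ≡ d
    φ⁻¹φ d = trans (cong rev (σσ⁻¹ (rev d))) (rev-rev d)

    σA σA⁻¹ : DartA → DartA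
    σA   (d , true)  = σ d , true
    σA   (d , false) = φ d , false
    σA⁻¹ (d , true)  = σ⁻¹ d , true
    σA⁻¹ (d , false) = φ⁻¹ d , false

    σA-σA⁻¹ : ∀ d → σA (σA⁻¹ d) ≡ d
    σA-σA⁻¹ (d , true)  = cong (_, true) (σσ⁻¹ d)
    σA-σA⁻¹ (d , false) = cong (_, false) (φφ⁻¹ d)

    σA⁻¹-σA : ∀ d → σA⁻¹ (σA d) ≡ d
    σA⁻¹-σA (d , true)  = cong (_, true) (σ⁻¹σ d)
    σA⁻¹-σA (d , false) = cong (_, false) (φ⁻¹φ d)

    φA : DartA → DartA
    φA (d , b) = σA⁻¹ (d , not b)

    tailA : DartA → Vertex ⊎ Face
    tailA (d , true)  = inj₁ (tail d)
    tailA (d , false) = inj₂ (left d)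

    tailA-surjective : ∀ v → ∃[ d ] tailA d ≡ v
    tailA-surjective (inj₁ v) = let d , eq = tail-surjective v in (d , true) , cong inj₁ eq
    tailA-surjective (inj₂ f) = let d , eq = left-surjective f in (d , false) , cong inj₂ eq

    tailA-σ : ∀ d → tailA (σA d) ≡ tailA d
    tailA-σ (d , true)  = cong inj₁ (tail-σ d)
    tailA-σ (d , false) = cong inj₂ (left-φ d)

    lift : ∀ {b} {f : Dart → Dart} → (∀ d → σA (d , b) ≡ (f d , b)) →
           ∀ {c d} → Orbit f c d → Orbit σA (c , b) (d , b)
    lift eq ε          = ε
    lift eq (refl ◅ o) = sym (eq _) ◅ lift eq o

    inj₁-inj : ∀ {u v} → _≡_ {A = Vertex ⊎ Face} (inj₁ u) (inj₁ v) → u ≡ v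
    inj₁-inj refl = refl

    inj₂-inj : ∀ {f g} → _≡_ {A = Vertex ⊎ Face} (inj₂ f) (inj₂ g) → f ≡ g
    inj₂-inj refl = refl

    tailA-orbit : ∀ c d → tailA c ≡ tailA d → Orbit σA c d
    tailA-orbit (c , true)  (d , true)  eq = lift (λ _ → refl) (tail-orbit c d (inj₁-inj eq))
    tailA-orbit (c , false) (d , false) eq = lift (λ _ → refl) (left-orbit c d (inj₂-inj eq))
    tailA-orbit (c , true)  (d , false) ()
    tailA-orbit (c , false) (d , true)  ()

    leftA : DartA → Edge
    leftA (d , true)  = edge (σ d)
    leftA (d , false) = edge d

    leftA-φ : ∀ d → leftA (φA d) ≡ leftA d
    leftA-φ (d , true)  = refl
    leftA-φ (d , false) = cong edge (σσ⁻¹ d)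

    rep : Edge → DartA
    rep e = (e , true) , false

    halfTurn : ∀ d → Orbit φA (d , false) (rev d , false)
    halfTurn d = refl ◅ cong (λ c → rev c , false) (sym (σσ⁻¹ d)) ◅ ε

    toRep : ∀ d → Orbit φA d (rep (leftA d))
    toRep ((e , true)  , false) = ε
    toRep ((e , false) , false) = halfTurn (e , false)
    toRep (d , true) with σ d in eq
    ... | e , true  = cong (λ c → rev c , false) (sym eq) ◅ halfTurn (e , false)
    ... | e , false = cong (λ c → rev c , false) (sym eq) ◅ ε

    fromRep : ∀ d → Orbit φA (rep (leftA d)) d
    fromRep ((e , true)  , false) = ε
    fromRep ((e , false) , false) = halfTurn (e , true)
    fromRep (d , true) with σ d in eq
    ... | e , true  = cong (_, true) (trans (sym (σ⁻¹σ d)) (cong σ⁻¹ eq)) ◅ ε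
    ... | e , false = halfTurn (e , true) ◅◅
                      cong (_, true) (trans (sym (σ⁻¹σ d)) (cong σ⁻¹ eq)) ◅ ε

cyclicPairs : {A : Set} → List A → List (A × A)
cyclicPairs []       = []
cyclicPairs (x ∷ xs) = zip (x ∷ xs) (xs ++ [ x ])

module _ (G : Map) where

  open Map G

  record IsFourOrientation (D : Orientation (angleMap G)) : Set where
    field
      primal : ∀ v → outdegree (angleMap G) D (inj₁ v) ≡ 4
      dual   : ∀ f → outdegree (angleMap G) D (inj₂ f) ≡ 1

  -- The angles met when turning counterclockwise from the dart a to the
  -- dart b with the same tail.  The number of darts bounds their number.
  sector : Dart → Dart → List Dart
  sector = go #D
    where
    go : ℕ → Dart → Dart → List Dart
    go zero    a b = []
    go (suc n) a b = if does (a D.≟ b) then [] else a ∷ go n (σ a) b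

  -- Where C arrives by the dart x and departs by the dart y, turning
  -- counterclockwise from rev x to y sweeps the right side of C.
  rightAngles leftAngles : Cycle G → List Dart
  rightAngles C = concatMap (λ (x , y) → sector (rev x) y) (cyclicPairs (Cycle.cycleDarts C))
  leftAngles  C = concatMap (λ (x , y) → sector y (rev x)) (cyclicPairs (Cycle.cycleDarts C))

  -- The edge of an angle a leaves its primal vertex when D a is true.
  γ : Orientation (angleMap G) → Cycle G → ℤ
  γ D C = length (filterᵇ D (rightAngles C)) ⊖ length (filterᵇ D (leftAngles C))

  IsBalanced : Orientation (angleMap G) → Set
  IsBalanced D = ∀ C → ¬ Contractible G C → γ D C ≡ 0ℤ

  record BalancedFourOrientation : Set where
    field
      orientation       : Orientation (angleMap G)
      isFourOrientation : IsFourOrientation orientation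
      isBalanced        : IsBalanced orientation

  open BalancedFourOrientation

  _≈ᴮ_ : Rel BalancedFourOrientation 0ℓ
  B ≈ᴮ B′ = ∀ a → orientation B a ≡ orientation B′ a

  BalancedBelow : Orientation (angleMap G) → Map.Face (angleMap G) →
                  Rel BalancedFourOrientation 0ℓ
  BalancedBelow R f₀ B B′ = Below (angleMap G) R f₀ (orientation B) (orientation B′)

-- The order between D and D′ asks for a nonnegative function λ on the faces
-- of the angle map (the edges of G), vanishing at f₀, whose increments across
-- the angles are the differences [D a] − [D′ a].  The main point is that for
-- balanced 4-orientations such a λ exists with integer values; it is unique
-- because G is connected.  The differences sum to 0 around each vertex, hence
-- they are the increments of a function p on darts, and λ exists as soon as
-- q(d) = p(d) − p(rev d) sums to 0 along all closed walks, which decompose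
-- into cycles and spurs.  Along a cycle C, twice the sum of q is
-- γ(D, C) − γ(D′, C), which is 0 if C is not contractible; if C bounds a disk,
-- the sum vanishes by summing the differences over the faces of the disk.
-- Conversely, adding increments of a function on the edges preserves outdegrees
-- and γ, so the pointwise maximum and minimum of two functions λ again come
-- from balanced 4-orientations, and the lattice is a sublattice of a power of ℤ.

module Submission where

open import Defs
import Algebra.Properties.Semiring.Sum as SemiringSum
open import Data.Bool.Base as Bool using (Bool; true; false; not; if_then_else_)
import Data.Bool.Properties as Bool
open import Data.Fin.Base as Fin using (Fin)
import Data.Fin.Properties as Fin
open import Data.Integer.Base as ℤ
  using (ℤ; 0ℤ; 1ℤ; +_; -[1+_]; _+_; _-_; _*_; -_; _⊔_; _⊓_; +≤+; -≤+)
import Data.Integer.Properties as ℤ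
open import Data.Integer.Tactic.RingSolver using (solve-∀)
open import Data.List.Base using (List; []; _∷_; [_]; _++_; map; concatMap; zip; length; filterᵇ)
import Data.List.Properties as List
open import Data.List.Membership.Propositional using (_∈_; _∉_)
open import Data.List.Membership.Propositional.Properties using (∈-map⁺)
import Data.List.Membership.DecPropositional as DecMembership
open import Data.List.Relation.Binary.Permutation.Propositional
  using (_↭_; ↭-trans; ↭-reflexive; ↭⇒↭ₛ)
open import Data.List.Relation.Binary.Permutation.Propositional.Properties using (drop-∷; ∷↭∷ʳ)
import Data.List.Relation.Binary.Permutation.Setoid.Properties as PermutationSetoid
open import Data.List.Relation.Unary.All as All using ([]; _∷_)
open import Data.List.Relation.Unary.All.Properties using (¬Any⇒All¬)
open import Data.List.Relation.Unary.AllPairs using ([]; _∷_)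
open import Data.List.Relation.Unary.Any using (here; there)
open import Data.List.Relation.Unary.Unique.Propositional using (Unique)
open import Data.Nat.Base as ℕ using (ℕ; zero; suc; _<_; _≤_; _∸_; z≤n; z<s; s<s)
open import Data.Nat.GeneralisedArithmetic using (fold; fold-+)
open import Data.Nat.Induction using (<-rec)
import Data.Nat.Properties as ℕ
open import Data.Product.Base using (_×_; _,_; proj₁; proj₂; ∃₂; ∃-syntax; Σ-syntax)
open import Data.Sum.Base using (_⊎_; inj₁; inj₂)
import Data.Sum.Properties as Sum
open import Function.Base using (_∘_)
open import Function.Bundles using (_↔_; _⇔_; mk⇔; mk↔ₛ′; Inverse; Equivalence)
open import Function.Construct.Composition using (_↔-∘_)
open import Function.Properties.Inverse using (↔-sym)
open import Level using (0ℓ)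
open import Relation.Binary.Construct.Closure.ReflexiveTransitive using (ε; _◅_; _◅◅_)
open import Relation.Binary.Definitions using (DecidableEquality)
open import Relation.Binary.Lattice.Structures using (IsDistributiveLattice)
open import Relation.Binary.PropositionalEquality
  using (_≡_; _≢_; refl; sym; trans; cong; cong₂; subst; subst₂; setoid; module ≡-Reasoning)
open import Relation.Nullary using (¬_; Dec; does; yes; no; contradiction)
open import Relation.Nullary.Decidable using (dec-true; dec-false; does-⇔; decidable-stable; _×-dec_)
open import Relation.Unary using (Pred; Decidable)
open ≡-Reasoning
open SemiringSum ℤ.+-*-semiring
  using (sum; sum-cong-≗; ∑-distrib-+; ∑-comm; sum-permute; *-distribˡ-sum; sum-replicate-zero)
open import Algebra.Properties.AbelianGroup ℤ.+-0-abelianGroup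
  using () renaming (∙-cancelˡ to +-cancelˡ; ∙-cancelʳ to +-cancelʳ)

-- Integer-valued sums over lists and finite types.

⟦_⟧ : Bool → ℤ
⟦ b ⟧ = + (if b then 1 else 0)

⟦∧⟧ : ∀ b c → ⟦ b Bool.∧ c ⟧ ≡ ⟦ b ⟧ * ⟦ c ⟧
⟦∧⟧ true  c = sym (ℤ.*-identityˡ ⟦ c ⟧)
⟦∧⟧ false c = refl

⟦not⟧ : ∀ b → ⟦ not b ⟧ ≡ 1ℤ - ⟦ b ⟧
⟦not⟧ true  = refl
⟦not⟧ false = refl

⟦⟧-injective : ∀ {b c} → ⟦ b ⟧ ≡ ⟦ c ⟧ → b ≡ c
⟦⟧-injective {true}  {true}  _ = refl
⟦⟧-injective {false} {false} _ = refl

∑ₗ : {A : Set} → (A → ℤ) → List A → ℤ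
∑ₗ f []       = 0ℤ
∑ₗ f (x ∷ xs) = f x + ∑ₗ f xs

module _ {A : Set} where

  ∑ₗ-cong : {f g : A → ℤ} → ∀ xs → (∀ x → x ∈ xs → f x ≡ g x) → ∑ₗ f xs ≡ ∑ₗ g xs
  ∑ₗ-cong []       eq = refl
  ∑ₗ-cong (x ∷ xs) eq = cong₂ _+_ (eq x (here refl)) (∑ₗ-cong xs λ y → eq y ∘ there)

  ∑ₗ-zero : {f : A → ℤ} → ∀ xs → (∀ x → x ∈ xs → f x ≡ 0ℤ) → ∑ₗ f xs ≡ 0ℤ
  ∑ₗ-zero []       eq = refl
  ∑ₗ-zero (x ∷ xs) eq = cong₂ _+_ (eq x (here refl)) (∑ₗ-zero xs λ y → eq y ∘ there)

  ∑ₗ-++ : (f : A → ℤ) → ∀ xs ys → ∑ₗ f (xs ++ ys) ≡ ∑ₗ f xs + ∑ₗ f ys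
  ∑ₗ-++ f []       ys = sym (ℤ.+-identityˡ _)
  ∑ₗ-++ f (x ∷ xs) ys = trans (cong (_+_ (f x)) (∑ₗ-++ f xs ys)) (sym (ℤ.+-assoc (f x) _ _))

  ∑ₗ-- : (f g : A → ℤ) → ∀ xs → ∑ₗ (λ x → f x - g x) xs ≡ ∑ₗ f xs - ∑ₗ g xs
  ∑ₗ-- f g []       = refl
  ∑ₗ-- f g (x ∷ xs) = trans (cong (_+_ (f x - g x)) (∑ₗ-- f g xs)) (rearrange (f x) (g x) (∑ₗ f xs) (∑ₗ g xs))
    where
    rearrange : ∀ a b c d → a - b + (c - d) ≡ a + c - (b + d)
    rearrange = solve-∀

  ∑ₗ-*ˡ : (c : ℤ) (f : A → ℤ) → ∀ xs → ∑ₗ (λ x → c * f x) xs ≡ c * ∑ₗ f xs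
  ∑ₗ-*ˡ c f []       = sym (ℤ.*-zeroʳ c)
  ∑ₗ-*ˡ c f (x ∷ xs) = trans (cong (_+_ (c * f x)) (∑ₗ-*ˡ c f xs)) (sym (ℤ.*-distribˡ-+ c _ _))

  ∑ₗ-map : {B : Set} (f : B → ℤ) (k : A → B) → ∀ xs → ∑ₗ f (map k xs) ≡ ∑ₗ (f ∘ k) xs
  ∑ₗ-map f k []       = refl
  ∑ₗ-map f k (x ∷ xs) = cong (_+_ (f (k x))) (∑ₗ-map f k xs)

∑ₗ-concatMap : {A B : Set} (f : B → ℤ) (k : A → List B) → ∀ xs →
               ∑ₗ f (concatMap k xs) ≡ ∑ₗ (∑ₗ f ∘ k) xs
∑ₗ-concatMap f k []       = refl
∑ₗ-concatMap f k (x ∷ xs) =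
  trans (∑ₗ-++ f (k x) (concatMap k xs)) (cong (_+_ (∑ₗ f (k x))) (∑ₗ-concatMap f k xs))

sum-select : ∀ {n} (j : Fin n) (f : Fin n → ℤ) → sum (λ i → ⟦ does (j Fin.≟ i) ⟧ * f i) ≡ f j
sum-select {suc n} Fin.zero    f = trans
  (cong₂ _+_ (ℤ.*-identityˡ (f Fin.zero)) (sum-replicate-zero n)) (ℤ.+-identityʳ _)
sum-select {suc n} (Fin.suc j) f = trans (ℤ.+-identityˡ _) (sum-select j (f ∘ Fin.suc))

module Summation {A : Set} {n : ℕ} (enum : Fin n ↔ A) where

  open Enumerated enum
  open Inverse enum using (to; from; strictlyInverseˡ; strictlyInverseʳ)

  ∑-cong : {f g : A → ℤ} → (∀ a → f a ≡ g a) → ∑ f ≡ ∑ g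
  ∑-cong eq = sum-cong-≗ (λ i → eq (to i))

  ∑-zero : {f : A → ℤ} → (∀ a → f a ≡ 0ℤ) → ∑ f ≡ 0ℤ
  ∑-zero eq = trans (∑-cong eq) (sum-replicate-zero n)

  ∑-+ : (f g : A → ℤ) → ∑ (λ a → f a + g a) ≡ ∑ f + ∑ g
  ∑-+ f g = ∑-distrib-+ (f ∘ to) (g ∘ to)

  ∑-*ˡ : (c : ℤ) (f : A → ℤ) → ∑ (λ a → c * f a) ≡ c * ∑ f
  ∑-*ˡ c f = sym (*-distribˡ-sum c (f ∘ to))

  ∑-- : (f g : A → ℤ) → ∑ (λ a → f a - g a) ≡ ∑ f - ∑ g
  ∑-- f g = begin
    ∑ (λ a → f a - g a)             ≡⟨ ∑-cong (λ a → cong (_+_ (f a)) (sym (ℤ.-1*i≡-i (g a)))) ⟩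
    ∑ (λ a → f a + ℤ.-1ℤ * g a)     ≡⟨ ∑-+ f (λ a → ℤ.-1ℤ * g a) ⟩
    ∑ f + ∑ (λ a → ℤ.-1ℤ * g a)     ≡⟨ cong (_+_ (∑ f)) (∑-*ˡ ℤ.-1ℤ g) ⟩
    ∑ f + ℤ.-1ℤ * ∑ g               ≡⟨ cong (_+_ (∑ f)) (ℤ.-1*i≡-i (∑ g)) ⟩
    ∑ f - ∑ g                       ∎

  ∑-permute : (π : A ↔ A) (f : A → ℤ) → ∑ (f ∘ Inverse.to π) ≡ ∑ f
  ∑-permute π f = begin
    ∑ (f ∘ Inverse.to π)
      ≡⟨ ∑-cong (λ a → cong f (sym (strictlyInverseˡ (Inverse.to π a)))) ⟩
    sum (λ i → f (to (from (Inverse.to π (to i)))))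
      ≡⟨ sym (sum-permute (f ∘ to) (↔-sym enum ↔-∘ (π ↔-∘ enum))) ⟩
    ∑ f                                             ∎

  ∑-select : (x : A) (f : A → ℤ) → ∑ (λ a → ⟦ does (x ≟ a) ⟧ * f a) ≡ f x
  ∑-select x f = begin
    ∑ (λ a → ⟦ does (x ≟ a) ⟧ * f a)
      ≡⟨ sum-cong-≗ (λ i → cong (λ b → ⟦ b ⟧ * f (to i))
           (does-⇔ (mk⇔ (forth i) (back i)) (x ≟ to i) (from x Fin.≟ i))) ⟩
    sum (λ i → ⟦ does (from x Fin.≟ i) ⟧ * f (to i)) ≡⟨ sum-select (from x) (f ∘ to) ⟩
    f (to (from x))                                  ≡⟨ cong f (strictlyInverseˡ x) ⟩
    f x                                              ∎
    where
    forth : ∀ i → x ≡ to i → from x ≡ i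
    forth i refl = strictlyInverseʳ i
    back : ∀ i → from x ≡ i → x ≡ to i
    back i refl = sym (strictlyInverseˡ x)

  +count : {P : Pred A 0ℓ} (P? : Decidable P) → + count P? ≡ ∑ (λ a → ⟦ does (P? a) ⟧)
  +count P? = go to
    where
    -- The enumeration is replaced by an arbitrary `t`, so that the induction can pass to its tail.
    go : ∀ {m} (t : Fin m → A) →
         + (SemiringSum.sum ℕ.+-*-semiring (λ i → indicator (P? (t i)))) ≡ sum (λ i → ⟦ does (P? (t i)) ⟧)
    go {zero}  t = refl
    go {suc m} t = trans (ℤ.pos-+ (indicator (P? (t Fin.zero))) _)
      (cong (_+_ ⟦ does (P? (t Fin.zero)) ⟧) (go (t ∘ Fin.suc)))

  count-nonzero : {P : Pred A 0ℓ} (P? : Decidable P) → ∀ {a} → P a → count P? ≢ 0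
  count-nonzero {P} P? {a} Pa = go to (from a) (subst P (sym (strictlyInverseˡ a)) Pa)
    where
    go : ∀ {m} (t : Fin m → A) (i : Fin m) → P (t i) →
         SemiringSum.sum ℕ.+-*-semiring (λ i → indicator (P? (t i))) ≢ 0
    go t Fin.zero    p eq with P? (t Fin.zero)
    ... | no ¬p = ¬p p
    go t (Fin.suc i) p eq =
      go (t ∘ Fin.suc) i p (ℕ.m+n≡0⇒n≡0 (indicator (P? (t Fin.zero))) eq)

  -- Induction on the list: `f` splits into its value at the first entry and the function `f′`
  -- erased there, which is supported on the remaining entries. Uniqueness ensures that the erasure
  -- does not touch them.
  ∑-support : (f : A → ℤ) → ∀ xs → Unique xs → (∀ a → a ∉ xs → f a ≡ 0ℤ) → ∑ f ≡ ∑ₗ f xs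
  ∑-support f []       _          out = ∑-zero (λ a → out a λ ())
  ∑-support f (x ∷ xs) (x∉ ∷ uxs) out = begin
    ∑ f                                               ≡⟨ ∑-cong split ⟩
    ∑ (λ a → ⟦ does (x ≟ a) ⟧ * f a + f′ a)           ≡⟨ ∑-+ (λ a → ⟦ does (x ≟ a) ⟧ * f a) f′ ⟩
    ∑ (λ a → ⟦ does (x ≟ a) ⟧ * f a) + ∑ f′           ≡⟨ cong₂ _+_ (∑-select x f) (∑-support f′ xs uxs out′) ⟩
    f x + ∑ₗ f′ xs                                    ≡⟨ cong (_+_ (f x)) (∑ₗ-cong xs agree) ⟩
    f x + ∑ₗ f xs                                     ∎
    where
    f′ : A → ℤ
    f′ a = if does (x ≟ a) then 0ℤ else f a
    split : ∀ a → f a ≡ ⟦ does (x ≟ a) ⟧ * f a + f′ a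
    split a with does (x ≟ a)
    ... | true  = sym (trans (ℤ.+-identityʳ _) (ℤ.*-identityˡ (f a)))
    ... | false = sym (ℤ.+-identityˡ (f a))
    out′ : ∀ a → a ∉ xs → f′ a ≡ 0ℤ
    out′ a a∉ = by-cases (x ≟ a)
      where
      -- The decision is made a variable, so that matching on it reduces the `if`.
      by-cases : (x≟a : Dec (x ≡ a)) → (if does x≟a then 0ℤ else f a) ≡ 0ℤ
      by-cases (yes _)  = refl
      by-cases (no x≢a) = out a λ { (here a≡x) → x≢a (sym a≡x) ; (there a∈) → a∉ a∈ }
    agree : ∀ a → a ∈ xs → f′ a ≡ f a
    agree a a∈ = cong (if_then 0ℤ else f a) (dec-false (x ≟ a) (All.lookup x∉ a∈))

module _ {A B : Set} {m n : ℕ} (enumA : Fin m ↔ A) (enumB : Fin n ↔ B) where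

  private
    module A = Enumerated enumA
    module B = Enumerated enumB

  ∑-fibres : (k : A → B) (f : A → ℤ) → A.∑ f ≡ B.∑ (λ b → A.∑ (λ a → ⟦ does (k a B.≟ b) ⟧ * f a))
  ∑-fibres k f = begin
    A.∑ f
      ≡⟨ Summation.∑-cong enumA (λ a → sym (Summation.∑-select enumB (k a) (λ _ → f a))) ⟩
    A.∑ (λ a → B.∑ (λ b → ⟦ does (k a B.≟ b) ⟧ * f a))
      ≡⟨ ∑-comm (λ i j → ⟦ does (k (Inverse.to enumA i) B.≟ Inverse.to enumB j) ⟧ * f (Inverse.to enumA i)) ⟩
    B.∑ (λ b → A.∑ (λ a → ⟦ does (k a B.≟ b) ⟧ * f a))     ∎

module _ (M : Map) where

  open Map M

  -- Used for the triangulation, to pair the two sides of an edge, and for its angle map, to pair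
  -- the two possible directions of an angle.
  ∑-darts : (f : Dart → ℤ) → D.∑ f ≡ E.∑ (λ e → f (e , true) + f (e , false))
  ∑-darts f = trans (∑-fibres darts edges edge f) (Summation.∑-cong edges fibre)
    where
    fibre : ∀ e → D.∑ (λ d → ⟦ does (edge d E.≟ e) ⟧ * f d) ≡ f (e , true) + f (e , false)
    fibre e = trans
      (Summation.∑-support darts _ ((e , true) ∷ (e , false) ∷ []) (((λ ()) ∷ []) ∷ [] ∷ []) out)
      (cong₂ _+_ (on true) (trans (ℤ.+-identityʳ _) (on false)))
      where
      on : ∀ b → ⟦ does (e E.≟ e) ⟧ * f (e , b) ≡ f (e , b)
      on b = trans (cong (λ c → ⟦ c ⟧ * f (e , b)) (dec-true (e E.≟ e) refl)) (ℤ.*-identityˡ _)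
      out : ∀ d → d ∉ (e , true) ∷ (e , false) ∷ [] → ⟦ does (edge d E.≟ e) ⟧ * f d ≡ 0ℤ
      out (e′ , b) d∉ = cong (λ c → ⟦ c ⟧ * f (e′ , b)) (dec-false (e′ E.≟ e) (ne b d∉))
        where
        ne : ∀ b → (e′ , b) ∉ (e , true) ∷ (e , false) ∷ [] → e′ ≢ e
        ne true  d∉ refl = d∉ (here refl)
        ne false d∉ refl = d∉ (there (here refl))

-- Iteration along orbits.

module _ {A : Set} (f : A → A) where

  iter : ℕ → A → A
  iter k a = fold a f k

  iter-comm : ∀ k a → iter k (f a) ≡ f (iter k a)
  iter-comm zero    a = refl
  iter-comm (suc k) a = cong f (iter-comm k a)

  orbit-iter : ∀ {a b} → Orbit f a b → ∃[ k ] iter k a ≡ b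
  orbit-iter ε          = 0 , refl
  orbit-iter (refl ◅ o) = let k , eq = orbit-iter o in suc k , trans (sym (iter-comm k _)) eq

  module _ {n : ℕ} (enum : Fin n ↔ A) where

    -- If `k` is at least `n`, two of the first `n + 1` iterates coincide by the pigeonhole
    -- principle, and cutting out the loop between them decreases `k`. The bound is what makes the
    -- fuel of `sector` sufficient.
    iter-bounded : ∀ {a b} k → iter k a ≡ b → ∃[ l ] l < n × iter l a ≡ b
    iter-bounded {a} {b} = <-rec _ shorten
      where
      open Inverse enum using (to; from; strictlyInverseˡ)
      shorten : ∀ k → (∀ {l} → l < k → iter l a ≡ b → ∃[ m ] m < n × iter m a ≡ b) →
                iter k a ≡ b → ∃[ m ] m < n × iter m a ≡ b
      shorten k rec reach with k ℕ.<? n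
      ... | yes k<n = k , k<n , reach
      ... | no  k≮n
        with i , j , i<j , same ← Fin.pigeonhole (ℕ.n<1+n n) (λ i → from (iter (Fin.toℕ i) a)) =
        rec (ℕ.<-≤-trans (ℕ.+-monoʳ-< (k ∸ j′) i<j) (ℕ.≤-reflexive (ℕ.m∸n+n≡m j≤k))) (begin
          iter (k ∸ j′ ℕ.+ i′) a  ≡⟨ fold-+ a f (k ∸ j′) ⟩
          iter (k ∸ j′) (iter i′ a) ≡⟨ cong (iter (k ∸ j′)) equal ⟩
          iter (k ∸ j′) (iter j′ a) ≡⟨ sym (fold-+ a f (k ∸ j′)) ⟩
          iter (k ∸ j′ ℕ.+ j′) a  ≡⟨ cong (λ l → iter l a) (ℕ.m∸n+n≡m j≤k) ⟩
          iter k a                ≡⟨ reach ⟩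
          b                       ∎)
        where
        i′ = Fin.toℕ i
        j′ = Fin.toℕ j
        j≤k : j′ ≤ k
        j≤k = ℕ.≤-trans (Fin.toℕ≤pred[n] j) (ℕ.≮⇒≥ k≮n)
        equal : iter i′ a ≡ iter j′ a
        equal = trans (sym (strictlyInverseˡ _)) (trans (cong to same) (strictlyInverseˡ _))

  sumAlong : (A → ℤ) → ℕ → A → ℤ
  sumAlong g zero    a = 0ℤ
  sumAlong g (suc k) a = sumAlong g k a + g (iter k a)

  sumAlong-+ : ∀ g k l a → sumAlong g (k ℕ.+ l) a ≡ sumAlong g l a + sumAlong g k (iter l a)
  sumAlong-+ g zero    l a = sym (ℤ.+-identityʳ _)
  sumAlong-+ g (suc k) l a = trans
    (cong₂ (λ x y → x + g y) (sumAlong-+ g k l a) (fold-+ a f k))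
    (ℤ.+-assoc (sumAlong g l a) _ _)

-- Potentials around a vertex.

module _ (G : Map) where

  open Map G

  rev-rev : ∀ d → rev (rev d) ≡ d
  rev-rev (e , b) = cong (e ,_) (Bool.not-involutive b)

  -- The angle `d` lies between the darts `d` and `σ d`, so its face is on the left of the former
  -- and on the right of the latter.
  left-rev-σ : ∀ d → left (rev (σ d)) ≡ left d
  left-rev-σ d = begin
    left (rev (σ d))     ≡⟨ sym (left-φ (rev (σ d))) ⟩
    left (φ (rev (σ d))) ≡⟨ cong (left ∘ σ⁻¹) (rev-rev (σ d)) ⟩
    left (σ⁻¹ (σ d))     ≡⟨ cong left (Inverse.strictlyInverseʳ rotation d) ⟩
    left d               ∎

  tail-iter : ∀ k d → tail (iter σ k d) ≡ tail d
  tail-iter zero    d = refl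
  tail-iter (suc k) d = trans (tail-σ (iter σ k d)) (tail-iter k d)

  iter-orbit : ∀ c d → tail c ≡ tail d → ∃[ k ] iter σ k c ≡ d
  iter-orbit c d eq = orbit-iter σ (tail-orbit c d eq)

  atTail : Vertex → Dart → ℤ
  atTail v d = ⟦ does (tail d V.≟ v) ⟧

  atFace : Face → Dart → ℤ
  atFace f d = ⟦ does (left d F.≟ f) ⟧

  open Summation darts using (∑-cong; ∑-zero; ∑-+; ∑-*ˡ; ∑-permute; +count; count-nonzero)

  -- In `z d` the dart `d` stands for the angle from `d` to `σ d`, whereas `p` is a function of the
  -- darts themselves: `z` is the discrete derivative of `p` around each vertex.
  IsIncrement : (z p : Dart → ℤ) → Set
  IsIncrement z p = ∀ d → z d ≡ p (σ d) - p d

  -- The value at d is the sum along the rotation from a fixed dart with the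
  -- same tail; going around a vertex contributes nothing.
  module LocalPotential (z : Dart → ℤ) (z-tail : ∀ v → D.∑ (λ d → atTail v d * z d) ≡ 0ℤ) where

    S : ℕ → Dart → ℤ
    S = sumAlong σ z

    -- Turning by `k` places permutes the darts at `v`.
    ∑-iter : ∀ k v → D.∑ (λ d → atTail v d * z (iter σ k d)) ≡ 0ℤ
    ∑-iter k v = begin
      D.∑ (λ d → atTail v d * z (iter σ k d))
        ≡⟨ ∑-cong (λ d → cong (λ u → ⟦ does (u V.≟ v) ⟧ * z (iter σ k d)) (sym (tail-iter k d))) ⟩
      D.∑ (λ d → atTail v (iter σ k d) * z (iter σ k d))
        ≡⟨ permute k (λ d → atTail v d * z d) ⟩
      D.∑ (λ d → atTail v d * z d)
        ≡⟨ z-tail v ⟩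
      0ℤ ∎
      where
      permute : ∀ k f → D.∑ (f ∘ iter σ k) ≡ D.∑ f
      permute zero    f = refl
      permute (suc k) f = trans (permute k (f ∘ σ)) (∑-permute rotation f)

    ∑-S : ∀ k v → D.∑ (λ d → atTail v d * S k d) ≡ 0ℤ
    ∑-S zero    v = ∑-zero (λ d → ℤ.*-zeroʳ (atTail v d))
    ∑-S (suc k) v = begin
      D.∑ (λ d → atTail v d * (S k d + z (iter σ k d)))
        ≡⟨ ∑-cong (λ d → ℤ.*-distribˡ-+ (atTail v d) (S k d) (z (iter σ k d))) ⟩
      D.∑ (λ d → atTail v d * S k d + atTail v d * z (iter σ k d))
        ≡⟨ ∑-+ (λ d → atTail v d * S k d) (λ d → atTail v d * z (iter σ k d)) ⟩
      D.∑ (λ d → atTail v d * S k d) + D.∑ (λ d → atTail v d * z (iter σ k d))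
        ≡⟨ cong₂ _+_ (∑-S k v) (∑-iter k v) ⟩
      0ℤ ∎

    -- Shifting the window of summation by one place drops `z a` and gains `z (iter σ k a)`, which
    -- are equal when `k` is a period.
    S-σ : ∀ k a → iter σ k a ≡ a → S k (σ a) ≡ S k a
    S-σ k a period = +-cancelˡ (z a) _ _ (begin
      z a + S k (σ a)        ≡⟨ cong (_+ S k (σ a)) (sym (ℤ.+-identityˡ (z a))) ⟩
      S 1 a + S k (σ a)      ≡⟨ sym (sumAlong-+ σ z k 1 a) ⟩
      S (k ℕ.+ 1) a          ≡⟨ cong (λ l → S l a) (ℕ.+-comm k 1) ⟩
      S k a + z (iter σ k a) ≡⟨ cong (λ d → S k a + z d) period ⟩
      S k a + z a            ≡⟨ ℤ.+-comm (S k a) (z a) ⟩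
      z a + S k a            ∎)

    S-orbit : ∀ k a → iter σ k a ≡ a → ∀ l → S k (iter σ l a) ≡ S k a
    S-orbit k a period zero    = refl
    S-orbit k a period (suc l) = trans (S-σ k (iter σ l a) (rotated l)) (S-orbit k a period l)
      where
      rotated : ∀ l → iter σ k (iter σ l a) ≡ iter σ l a
      rotated zero    = period
      rotated (suc l) = trans (iter-comm σ k _) (cong σ (rotated l))

    -- Summing S k over the darts at a vertex gives a multiple of S k a, and
    -- it gives 0 since each term of S k sums to 0.
    S-period : ∀ k a → iter σ k a ≡ a → S k a ≡ 0ℤ
    S-period k a period with ℤ.i*j≡0⇒i≡0∨j≡0 (S k a) product
      where
      v = tail a
      constant : ∀ d → atTail v d * S k d ≡ S k a * atTail v d
      constant d = by-cases (tail d V.≟ v)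
        where
        by-cases : (t? : Dec (tail d ≡ v)) → ⟦ does t? ⟧ * S k d ≡ S k a * ⟦ does t? ⟧
        by-cases (no _)   = sym (ℤ.*-zeroʳ (S k a))
        by-cases (yes td) with l , refl ← iter-orbit a d (sym td) =
          trans (cong (1ℤ *_) (S-orbit k a period l)) (ℤ.*-comm 1ℤ (S k a))
      product : S k a * + D.count (λ d → tail d V.≟ v) ≡ 0ℤ
      product = begin
        S k a * + D.count (λ d → tail d V.≟ v) ≡⟨ cong (S k a *_) (+count (λ d → tail d V.≟ v)) ⟩
        S k a * D.∑ (atTail v)                 ≡⟨ sym (∑-*ˡ (S k a) (atTail v)) ⟩
        D.∑ (λ d → S k a * atTail v d)         ≡⟨ ∑-cong (λ d → sym (constant d)) ⟩
        D.∑ (λ d → atTail v d * S k d)         ≡⟨ ∑-S k v ⟩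
        0ℤ                                     ∎
    ... | inj₁ S≡0 = S≡0
    -- The degree of the vertex is not zero, since `a` itself is counted.
    ... | inj₂ c≡0 = contradiction (ℤ.+-injective c≡0) (count-nonzero (λ d → tail d V.≟ tail a) {a} refl)

    -- Continuing both runs by the same `m` turns from their common end back to `a` makes both into
    -- periods, whose sums vanish. Hence the choice of the number of turns in `steps` does not
    -- affect `potential`.
    S-unique : ∀ k l a → iter σ k a ≡ iter σ l a → S k a ≡ S l a
    S-unique k l a eq = +-cancelʳ (S m b) _ _ (begin
      S k a + S m b            ≡⟨ sym (sumAlong-+ σ z m k a) ⟩
      S (m ℕ.+ k) a            ≡⟨ S-period (m ℕ.+ k) a (trans (fold-+ a σ m) back) ⟩
      0ℤ
        ≡⟨ sym (S-period (m ℕ.+ l) a (trans (fold-+ a σ m) (trans (cong (iter σ m) (sym eq)) back))) ⟩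
      S (m ℕ.+ l) a            ≡⟨ sumAlong-+ σ z m l a ⟩
      S l a + S m (iter σ l a) ≡⟨ cong (λ d → S l a + S m d) (sym eq) ⟩
      S l a + S m b            ∎)
      where
      b = iter σ k a
      return = iter-orbit b a (tail-iter k a)
      m = proj₁ return
      back = proj₂ return

    origin : Vertex → Dart
    origin v = proj₁ (tail-surjective v)

    steps : ∀ d → ∃[ k ] iter σ k (origin (tail d)) ≡ d
    steps d = iter-orbit _ d (proj₂ (tail-surjective (tail d)))

    potential : Dart → ℤ
    potential d = S (proj₁ (steps d)) (origin (tail d))

    potential-increment : IsIncrement z potential
    potential-increment d = begin
      z d                       ≡⟨ rearrange (potential d) (z d) ⟩
      potential d + z d - potential d
        ≡⟨ cong (λ c → potential d + z c - potential d) (sym (proj₂ (steps d))) ⟩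
      S (suc k) o - potential d
        ≡⟨ cong (_- potential d) (S-unique (suc k) l o (trans (cong σ (proj₂ (steps d))) (sym reach))) ⟩
      S l o - potential d       ≡⟨ cong (λ v → S l (origin v) - potential d) (sym (tail-σ d)) ⟩
      potential (σ d) - potential d ∎
      where
      o = origin (tail d)
      k = proj₁ (steps d)
      l = proj₁ (steps (σ d))
      reach : iter σ l o ≡ σ d
      reach = subst (λ v → iter σ l (origin v) ≡ σ d) (tail-σ d) (proj₂ (steps (σ d)))
      rearrange : ∀ a b → b ≡ a + b - a
      rearrange = solve-∀

  -- The local function that sector iterates is not exported; abstracting
  -- over #D turns its application into a pattern that unification solves.
  private
    mutual
      turn : ℕ → Dart → Dart → List Dart
      turn = _

      turn-sector : ∀ a b → turn #D a b ≡ sector G a b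
      turn-sector a b with #D
      ... | n = refl

  -- Sums over sectors and the change of γ along a cycle.

  module _ {z p : Dart → ℤ} (inc : IsIncrement z p) where

    -- The increments telescope. The hypothesis `k < n` ensures that `b` is met before the fuel `n`
    -- runs out; `k` need not be the first time at which `b` is met.
    ∑-turn : ∀ n k a b → k < n → iter σ k a ≡ b → ∑ₗ z (turn n a b) ≡ p b - p a
    ∑-turn (suc n) k a b k<n reach = by-cases (a D.≟ b)
      where
      rearrange : ∀ x y w → y - x + (w - y) ≡ w - x
      rearrange = solve-∀
      step-case : ∀ k → k < suc n → a ≢ b → iter σ k a ≡ b → z a + ∑ₗ z (turn n (σ a) b) ≡ p b - p a
      step-case zero    k<n       a≢b eq = contradiction eq a≢b
      step-case (suc k) (s<s k<n) a≢b eq = begin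
        z a + ∑ₗ z (turn n (σ a) b)
          ≡⟨ cong₂ _+_ (inc a) (∑-turn n k (σ a) b k<n (trans (iter-comm σ k a) eq)) ⟩
        p (σ a) - p a + (p b - p (σ a))
          ≡⟨ rearrange (p a) (p (σ a)) (p b) ⟩
        p b - p a ∎
      by-cases : (a≟b : Dec (a ≡ b)) →
                 ∑ₗ z (if does a≟b then [] else a ∷ turn n (σ a) b) ≡ p b - p a
      by-cases (yes refl) = sym (ℤ.+-inverseʳ (p a))
      by-cases (no a≢b)   = step-case k k<n a≢b reach

    ∑-sector : ∀ a b → tail a ≡ tail b → ∑ₗ z (sector G a b) ≡ p b - p a
    ∑-sector a b eq =
      let k , reach = iter-orbit a b eq
          l , l<n , reach′ = iter-bounded σ darts k reach
      in trans (cong (∑ₗ z) (sym (turn-sector a b))) (∑-turn #D l a b l<n reach′)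

  -- The function q of the outline. A potential is determined at each vertex only up to a constant;
  -- the jump along `d` is how much the constant at the head must exceed that at the tail for the
  -- two darts of the edge to receive the same value.
  jump : (Dart → ℤ) → Dart → ℤ
  jump p d = p d - p (rev d)

  -- Each term combines a departing dart with the reverse of an arriving one. Regrouping by darts
  -- instead of by vertices gives the jumps of the darts of `w` and leaves one term for each end.
  ∑-zip : (p : Dart → ℤ) (g : Dart × Dart → ℤ) →
          (∀ x y → head x ≡ tail y → g (x , y) ≡ p y - p (rev x)) →
          ∀ {u v} x (w : Walk G u v) y → head x ≡ u → v ≡ tail y →
          ∑ₗ g (zip (x ∷ walkDarts G w) (walkDarts G w ++ [ y ])) ≡
          ∑ₗ (jump p) (walkDarts G w) + (p y - p (rev x))
  ∑-zip p g g-eq x ε y x-head eq = trans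
    (ℤ.+-identityʳ _) (trans (g-eq x y (trans x-head eq)) (sym (ℤ.+-identityˡ _)))
  ∑-zip p g g-eq x (step d d-tail d-head ◅ w) y x-head eq = begin
    g (x , d) + ∑ₗ g (zip (d ∷ walkDarts G w) (walkDarts G w ++ [ y ]))
      ≡⟨ cong₂ _+_ (g-eq x d (trans x-head (sym d-tail))) (∑-zip p g g-eq d w y d-head eq) ⟩
    p d - p (rev x) + (∑ₗ (jump p) (walkDarts G w) + (p y - p (rev d)))
      ≡⟨ rearrange (p d) (p (rev x)) (∑ₗ (jump p) (walkDarts G w)) (p y) (p (rev d)) ⟩
    jump p d + ∑ₗ (jump p) (walkDarts G w) + (p y - p (rev x)) ∎
    where
    rearrange : ∀ a b c d e → a - b + (c + (d - e)) ≡ a - e + c + (d - b)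
    rearrange = solve-∀

  ∑-cyclicPairs : (p : Dart → ℤ) (g : Dart × Dart → ℤ) →
                  (∀ x y → head x ≡ tail y → g (x , y) ≡ p y - p (rev x)) →
                  ∀ {u} (w : Walk G u u) →
                  ∑ₗ g (cyclicPairs (walkDarts G w)) ≡ ∑ₗ (jump p) (walkDarts G w)
  ∑-cyclicPairs p g g-eq ε = refl
  -- Here `d` is both the first arriving and the last departing dart, so the two end terms form its
  -- own jump.
  ∑-cyclicPairs p g g-eq (step d d-tail d-head ◅ w) = trans
    (∑-zip p g g-eq d w d d-head (sym d-tail)) (ℤ.+-comm (∑ₗ (jump p) (walkDarts G w)) (jump p d))

  length-filter : (D : Dart → Bool) → ∀ xs → + length (filterᵇ D xs) ≡ ∑ₗ (⟦_⟧ ∘ D) xs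
  length-filter D []       = refl
  length-filter D (x ∷ xs) with D x
  ... | true  = cong (_+_ 1ℤ) (length-filter D xs)
  ... | false = trans (length-filter D xs) (sym (ℤ.+-identityˡ _))

  change : (D D′ : Dart → Bool) → Dart → ℤ
  change D D′ a = ⟦ D a ⟧ - ⟦ D′ a ⟧

  -- At each vertex of the cycle the right sector turns from `rev x` to `y` and the left one from
  -- `y` back to `rev x`. Their sums of increments are opposite, and subtracting them gives the
  -- factor 2.
  γ-change : ∀ {D D′ p} → IsIncrement (change D D′) p → ∀ C →
             γ G D C - γ G D′ C ≡ + 2 * ∑ₗ (jump p) (Cycle.cycleDarts C)
  γ-change {D} {D′} {p} inc C = begin
    γ G D C - γ G D′ C
      ≡⟨ cong₂ _-_ (γ-sum D) (γ-sum D′) ⟩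
    (∑ₗ (⟦_⟧ ∘ D) R - ∑ₗ (⟦_⟧ ∘ D) L) - (∑ₗ (⟦_⟧ ∘ D′) R - ∑ₗ (⟦_⟧ ∘ D′) L)
      ≡⟨ rearrange (∑ₗ (⟦_⟧ ∘ D) R) _ _ _ ⟩
    (∑ₗ (⟦_⟧ ∘ D) R - ∑ₗ (⟦_⟧ ∘ D′) R) - (∑ₗ (⟦_⟧ ∘ D) L - ∑ₗ (⟦_⟧ ∘ D′) L)
      ≡⟨ sym (cong₂ _-_ (∑ₗ-- (⟦_⟧ ∘ D) (⟦_⟧ ∘ D′) R) (∑ₗ-- (⟦_⟧ ∘ D) (⟦_⟧ ∘ D′) L)) ⟩
    ∑ₗ z R - ∑ₗ z L
      ≡⟨ cong₂ _-_ right left′ ⟩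
    K - ℤ.-1ℤ * K
      ≡⟨ double K ⟩
    + 2 * K ∎
    where
    z = change D D′
    R = rightAngles G C
    L = leftAngles G C
    xs = cyclicPairs (Cycle.cycleDarts C)
    K = ∑ₗ (jump p) (Cycle.cycleDarts C)
    γ-sum : ∀ D → γ G D C ≡ ∑ₗ (⟦_⟧ ∘ D) R - ∑ₗ (⟦_⟧ ∘ D) L
    γ-sum D = trans
      (sym (ℤ.m-n≡m⊖n (length (filterᵇ D R)) (length (filterᵇ D L))))
      (cong₂ _-_ (length-filter D R) (length-filter D L))
    rearrange : ∀ a b c d → (a - b) - (c - d) ≡ (a - c) - (b - d)
    rearrange = solve-∀
    double : ∀ a → a - ℤ.-1ℤ * a ≡ + 2 * a
    double = solve-∀
    negate : ∀ a b → a - b ≡ ℤ.-1ℤ * (b - a)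
    negate = solve-∀
    right : ∑ₗ z R ≡ K
    right = trans
      (∑ₗ-concatMap z (λ (x , y) → sector G (rev x) y) xs)
      (∑-cyclicPairs p _ (λ x y eq → ∑-sector {p = p} inc (rev x) y eq) (Cycle.walk C))
    left′ : ∑ₗ z L ≡ ℤ.-1ℤ * K
    left′ = begin
      ∑ₗ z L
        ≡⟨ ∑ₗ-concatMap z (λ (x , y) → sector G y (rev x)) xs ⟩
      ∑ₗ (λ (x , y) → ∑ₗ z (sector G y (rev x))) xs
        -- A double sign is inserted because `∑-cyclicPairs` expects the increment from `rev x` to
        -- `y`, which is the negative of the sum over the left sector.
        ≡⟨ ∑ₗ-cong xs (λ (x , y) _ → sym (double-neg (∑ₗ z (sector G y (rev x))))) ⟩
      ∑ₗ (λ (x , y) → ℤ.-1ℤ * (ℤ.-1ℤ * ∑ₗ z (sector G y (rev x)))) xs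
        ≡⟨ ∑ₗ-*ˡ ℤ.-1ℤ (λ (x , y) → ℤ.-1ℤ * ∑ₗ z (sector G y (rev x))) xs ⟩
      ℤ.-1ℤ * ∑ₗ (λ (x , y) → ℤ.-1ℤ * ∑ₗ z (sector G y (rev x))) xs
        ≡⟨ cong (ℤ.-1ℤ *_) (∑-cyclicPairs p _ flipped (Cycle.walk C)) ⟩
      ℤ.-1ℤ * K ∎
      where
      double-neg : ∀ a → ℤ.-1ℤ * (ℤ.-1ℤ * a) ≡ a
      double-neg = solve-∀
      flipped : ∀ x y → head x ≡ tail y → ℤ.-1ℤ * ∑ₗ z (sector G y (rev x)) ≡ p y - p (rev x)
      flipped x y eq = trans
        (cong (ℤ.-1ℤ *_) (∑-sector {p = p} inc y (rev x) (sym eq)))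
        (sym (negate (p y) (p (rev x))))

-- Cycles that bound a disk.

Unique-resp-↭ : {A : Set} {xs ys : List A} → xs ↭ ys → Unique xs → Unique ys
Unique-resp-↭ p = PermutationSetoid.Unique-resp-↭ (setoid _) (↭⇒↭ₛ p)

∑ₗ-select : {A B : Set} (_≟_ : DecidableEquality B) (k : A → B) (f : A → ℤ) →
            ∀ {x} xs → Unique (map k xs) → x ∈ xs →
            ∑ₗ (λ y → f y * ⟦ does (k y ≟ k x) ⟧) xs ≡ f x
∑ₗ-select _≟_ k f {x} (y ∷ ys) (y∉ ∷ uys) (here refl) = begin
  f y * ⟦ does (k y ≟ k y) ⟧ + ∑ₗ (λ w → f w * ⟦ does (k w ≟ k y) ⟧) ys
    ≡⟨ cong₂ (λ b i → f y * ⟦ b ⟧ + i) (dec-true (k y ≟ k y) refl) (∑ₗ-zero ys others) ⟩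
  f y * 1ℤ + 0ℤ ≡⟨ trans (ℤ.+-identityʳ _) (ℤ.*-identityʳ (f y)) ⟩
  f y           ∎
  where
  others : ∀ w → w ∈ ys → f w * ⟦ does (k w ≟ k y) ⟧ ≡ 0ℤ
  others w w∈ = trans
    (cong (λ b → f w * ⟦ b ⟧) (dec-false (k w ≟ k y) λ eq → All.lookup y∉ (∈-map⁺ k w∈) (sym eq)))
    (ℤ.*-zeroʳ (f w))
∑ₗ-select _≟_ k f {x} (y ∷ ys) (y∉ ∷ uys) (there x∈) = begin
  f y * ⟦ does (k y ≟ k x) ⟧ + ∑ₗ (λ w → f w * ⟦ does (k w ≟ k x) ⟧) ys
    ≡⟨ cong₂ (λ b i → f y * ⟦ b ⟧ + i) (dec-false (k y ≟ k x) (All.lookup y∉ (∈-map⁺ k x∈)))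
         (∑ₗ-select _≟_ k f ys uys x∈) ⟩
  f y * 0ℤ + f x ≡⟨ cong (_+ f x) (ℤ.*-zeroʳ (f y)) ⟩
  0ℤ + f x       ≡⟨ ℤ.+-identityˡ (f x) ⟩
  f x            ∎

module _ (G : Map) where

  open Map G
  open Summation darts using (∑-cong; ∑-zero; ∑-*ˡ; ∑--; ∑-permute)

  walk-heads : ∀ {u v} (w : Walk G u v) →
               u ∷ map head (walkDarts G w) ≡ map tail (walkDarts G w) ++ [ v ]
  walk-heads ε                       = refl
  walk-heads (step d refl refl ◅ w) = cong (tail d ∷_) (walk-heads w)

  -- Along a closed walk the heads are the tails shifted cyclically by one place.
  unique-heads : ∀ {u} (w : Walk G u u) → Unique (map tail (walkDarts G w)) →
                 Unique (map head (walkDarts G w))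
  unique-heads {u} w = Unique-resp-↭ (drop-∷ (↭-trans
    (∷↭∷ʳ u (map tail (walkDarts G w))) (↭-reflexive (sym (walk-heads w)))))

  -- The region is the set of faces to the left of the cycle or that of the
  -- faces to its right; side tells which.  Abel summation around the
  -- vertices turns a sum over the faces of the region into a sum over its
  -- boundary.
  module Boundary (C : Cycle G) (disk : Contractible G C) where

    open EnclosesDisk disk using (region; boundary)
    open Cycle C using (walk; cycleDarts; simple; edge-simple; nonempty)

    inside : Dart → ℤ
    inside d = ⟦ region (left d) ⟧

    side : Dart → ℤ
    side d = inside d - inside (rev d)

    side-rev : ∀ d → side (rev d) ≡ - side d
    side-rev d = trans (cong (λ c → inside (rev d) - inside c) (rev-rev G d)) (flip (inside (rev d)) (inside d))
      where
      flip : ∀ a b → a - b ≡ - (b - a)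
      flip = solve-∀

    -- In the sum weighted by `inside (rev d)` the variable is rotated to `σ d`; as `rev (σ d)` and
    -- `d` have the same face on their left, both sums then carry the weight `inside d`.
    ∑-side-inside : (p : Dart → ℤ) → D.∑ (λ d → side d * p d) ≡ D.∑ (λ d → inside d * (p d - p (σ d)))
    ∑-side-inside p = begin
      D.∑ (λ d → side d * p d)
        ≡⟨ ∑-cong (λ d → distrib (inside d) (inside (rev d)) (p d)) ⟩
      D.∑ (λ d → inside d * p d - inside (rev d) * p d)
        ≡⟨ ∑-- (λ d → inside d * p d) (λ d → inside (rev d) * p d) ⟩
      D.∑ (λ d → inside d * p d) - D.∑ (λ d → inside (rev d) * p d)
        ≡⟨ cong (_-_ (D.∑ (λ d → inside d * p d))) (sym (∑-permute rotation (λ d → inside (rev d) * p d))) ⟩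
      D.∑ (λ d → inside d * p d) - D.∑ (λ d → inside (rev (σ d)) * p (σ d))
        ≡⟨ cong (_-_ (D.∑ (λ d → inside d * p d))) (∑-cong (λ d → cong (λ f → ⟦ region f ⟧ * p (σ d)) (left-rev-σ G d))) ⟩
      D.∑ (λ d → inside d * p d) - D.∑ (λ d → inside d * p (σ d))
        ≡⟨ sym (∑-- (λ d → inside d * p d) (λ d → inside d * p (σ d))) ⟩
      D.∑ (λ d → inside d * p d - inside d * p (σ d))
        ≡⟨ ∑-cong (λ d → factor (inside d) (p d) (p (σ d))) ⟩
      D.∑ (λ d → inside d * (p d - p (σ d))) ∎
      where
      distrib : ∀ a b c → (a - b) * c ≡ a * c - b * c
      distrib = solve-∀
      factor : ∀ a b c → a * b - a * c ≡ a * (b - c)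
      factor = solve-∀

    -- As `side` changes sign under reversal, the two darts of an edge together contribute a jump.
    -- Edges off the cycle have both sides in the region or both outside it, and edge-simplicity
    -- lets each edge of the cycle count once.
    ∑-side-cycle : (p : Dart → ℤ) → D.∑ (λ d → side d * p d) ≡ ∑ₗ (λ d → side d * jump G p d) cycleDarts
    ∑-side-cycle p = begin
      D.∑ (λ d → side d * p d)                   ≡⟨ ∑-darts G (λ d → side d * p d) ⟩
      E.∑ across
        ≡⟨ Summation.∑-support edges across (map edge cycleDarts) edge-simple off ⟩
      ∑ₗ across (map edge cycleDarts)            ≡⟨ ∑ₗ-map across edge cycleDarts ⟩
      ∑ₗ (across ∘ edge) cycleDarts              ≡⟨ ∑ₗ-cong cycleDarts (λ d _ → on d) ⟩
      ∑ₗ (λ d → side d * jump G p d) cycleDarts  ∎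
      where
      across : Edge → ℤ
      across e = side (e , true) * p (e , true) + side (e , false) * p (e , false)
      antisym : ∀ s a b → s * a + - s * b ≡ s * (a - b)
      antisym = solve-∀
      on : ∀ d → across (edge d) ≡ side d * jump G p d
      on (e , true)  = trans
        (cong (λ s → side (e , true) * p (e , true) + s * p (e , false)) (side-rev (e , true)))
        (antisym (side (e , true)) (p (e , true)) (p (e , false)))
      on (e , false) = trans
        (ℤ.+-comm (side (e , true) * p (e , true)) (side (e , false) * p (e , false))) (trans
        (cong (λ s → side (e , false) * p (e , false) + s * p (e , true)) (side-rev (e , false)))
        (antisym (side (e , false)) (p (e , false)) (p (e , true))))
      off : ∀ e → e ∉ map edge cycleDarts → across e ≡ 0ℤ
      off e e∉ = trans (on (e , true)) (trans
        (cong (_* jump G p (e , true)) (ℤ.i≡j⇒i-j≡0 (cong ⟦_⟧ same)))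
        refl)
        where
        same : region (left (e , true)) ≡ region (left (e , false))
        same = decidable-stable (_ Bool.≟ _) (e∉ ∘ Equivalence.from (boundary e))

    -- The two preceding identities are applied to the indicator `at` of the darts leaving the
    -- common vertex. It is constant under rotation, so the sum is 0; on the cycle only `y` leaves
    -- the vertex and only `x` enters it, so the sum is also `side y - side x`.
    side-consecutive : ∀ {x y} → x ∈ cycleDarts → y ∈ cycleDarts → head x ≡ tail y → side x ≡ side y
    side-consecutive {x} {y} x∈ y∈ xy = sym (ℤ.i-j≡0⇒i≡j (side y) (side x) (begin
      side y - side x
        ≡⟨ sym (cong₂ _-_ (∑ₗ-select V._≟_ tail side cycleDarts simple y∈)
             (∑ₗ-select V._≟_ head side cycleDarts (unique-heads walk simple) x∈)) ⟩
      ∑ₗ (λ d → side d * atTail G (tail y) d) cycleDarts - ∑ₗ (λ d → side d * atTail G (head x) (rev d)) cycleDarts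
        ≡⟨ cong (λ v → ∑ₗ (λ d → side d * atTail G (tail y) d) cycleDarts -
                       ∑ₗ (λ d → side d * atTail G v (rev d)) cycleDarts) xy ⟩
      ∑ₗ (λ d → side d * at d) cycleDarts - ∑ₗ (λ d → side d * at (rev d)) cycleDarts
        ≡⟨ sym (∑ₗ-- (λ d → side d * at d) (λ d → side d * at (rev d)) cycleDarts) ⟩
      ∑ₗ (λ d → side d * at d - side d * at (rev d)) cycleDarts
        ≡⟨ ∑ₗ-cong cycleDarts (λ d _ → factor (side d) (at d) (at (rev d))) ⟩
      ∑ₗ (λ d → side d * jump G at d) cycleDarts
        ≡⟨ sym (∑-side-cycle at) ⟩
      D.∑ (λ d → side d * at d)
        ≡⟨ ∑-side-inside at ⟩
      D.∑ (λ d → inside d * (at d - at (σ d)))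
        ≡⟨ ∑-zero (λ d → trans (cong (inside d *_) (ℤ.i≡j⇒i-j≡0
             (cong (λ u → ⟦ does (u V.≟ tail y) ⟧) (sym (tail-σ d))))) (ℤ.*-zeroʳ (inside d))) ⟩
      0ℤ ∎))
      where
      at = atTail G (tail y)
      factor : ∀ a b c → a * b - a * c ≡ a * (b - c)
      factor = solve-∀

    side-along : ∀ {u v} {x} (w : Walk G u v) → head x ≡ u → x ∈ cycleDarts →
                 (∀ y → y ∈ walkDarts G w → y ∈ cycleDarts) → ∀ y → y ∈ walkDarts G w → side y ≡ side x
    side-along (step d d-tail d-head ◅ w) x-head x∈ sub y y∈ = along y∈
      where
      first = sym (side-consecutive x∈ (sub d (here refl)) (trans x-head (sym d-tail)))
      along : y ∈ d ∷ walkDarts G w → side y ≡ _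
      along (here refl) = first
      along (there y∈)  = trans (side-along w d-head (sub d (here refl)) (λ c → sub c ∘ there) y y∈) first

    side≢0 : ∀ {d} → d ∈ cycleDarts → side d ≢ 0ℤ
    side≢0 {d} d∈ eq = crossing d d∈ (⟦⟧-injective (ℤ.i-j≡0⇒i≡j _ _ eq))
      where
      crossing : ∀ d → d ∈ cycleDarts → region (left d) ≢ region (left (rev d))
      crossing (e , true)  d∈ = Equivalence.to (boundary e) (∈-map⁺ edge d∈)
      crossing (e , false) d∈ = Equivalence.to (boundary e) (∈-map⁺ edge d∈) ∘ sym

    -- Summed over the faces of the region, `z` gives 0. By the boundary identities this is, up to
    -- sign, the sum of the jumps weighted by `side`, which is constant and nonzero on the cycle and
    -- can be cancelled.
    ∑-jump≡0 : ∀ {z p} → IsIncrement G z p → (∀ f → D.∑ (λ d → atFace G f d * z d) ≡ 0ℤ) →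
               ∑ₗ (jump G p) cycleDarts ≡ 0ℤ
    ∑-jump≡0 {z} {p} inc z-left = from-side walk refl
      where
      ∑-inside : D.∑ (λ d → inside d * z d) ≡ 0ℤ
      ∑-inside = begin
        D.∑ (λ d → inside d * z d)
          ≡⟨ ∑-fibres darts faces left (λ d → inside d * z d) ⟩
        F.∑ (λ f → D.∑ (λ d → atFace G f d * (inside d * z d)))
          ≡⟨ Summation.∑-cong faces (λ f → trans (∑-cong (λ d → pull f d)) (∑-*ˡ ⟦ region f ⟧ (λ d → atFace G f d * z d))) ⟩
        F.∑ (λ f → ⟦ region f ⟧ * D.∑ (λ d → atFace G f d * z d))
          ≡⟨ Summation.∑-zero faces (λ f → trans (cong (⟦ region f ⟧ *_) (z-left f)) (ℤ.*-zeroʳ ⟦ region f ⟧)) ⟩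
        0ℤ ∎
        where
        shuffle : ∀ a b c → a * (b * c) ≡ b * (a * c)
        shuffle = solve-∀
        pull : ∀ f d → atFace G f d * (inside d * z d) ≡ ⟦ region f ⟧ * (atFace G f d * z d)
        pull f d = by-cases (left d F.≟ f)
          where
          by-cases : (t? : Dec (left d ≡ f)) → ⟦ does t? ⟧ * (inside d * z d) ≡ ⟦ region f ⟧ * (⟦ does t? ⟧ * z d)
          by-cases (yes refl) = shuffle 1ℤ (inside d) (z d)
          by-cases (no _)     = sym (ℤ.*-zeroʳ ⟦ region f ⟧)
      ∑-side : ∑ₗ (λ d → side d * jump G p d) cycleDarts ≡ 0ℤ
      ∑-side = begin
        ∑ₗ (λ d → side d * jump G p d) cycleDarts ≡⟨ sym (∑-side-cycle p) ⟩
        D.∑ (λ d → side d * p d)                  ≡⟨ ∑-side-inside p ⟩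
        D.∑ (λ d → inside d * (p d - p (σ d)))
          ≡⟨ ∑-cong (λ d → trans (negate (inside d) (p d) (p (σ d))) (cong (λ i → ℤ.-1ℤ * (inside d * i)) (sym (inc d)))) ⟩
        D.∑ (λ d → ℤ.-1ℤ * (inside d * z d))      ≡⟨ ∑-*ˡ ℤ.-1ℤ (λ d → inside d * z d) ⟩
        ℤ.-1ℤ * D.∑ (λ d → inside d * z d)        ≡⟨ cong (ℤ.-1ℤ *_) ∑-inside ⟩
        0ℤ                                        ∎
        where
        negate : ∀ a b c → a * (b - c) ≡ ℤ.-1ℤ * (a * (c - b))
        negate = solve-∀
      -- The walk is generalised so that it can be matched on; its first dart `d` supplies the
      -- common value of `side`.
      from-side : ∀ {u} (w : Walk G u u) → walkDarts G w ≡ cycleDarts → ∑ₗ (jump G p) cycleDarts ≡ 0ℤ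
      from-side ε eq = contradiction (sym eq) nonempty
      from-side (step d _ d-head ◅ w) eq with ℤ.i*j≡0⇒i≡0∨j≡0 (side d) (begin
        side d * ∑ₗ (jump G p) cycleDarts         ≡⟨ sym (∑ₗ-*ˡ (side d) (jump G p) cycleDarts) ⟩
        ∑ₗ (λ c → side d * jump G p c) cycleDarts
          ≡⟨ ∑ₗ-cong cycleDarts (λ c c∈ → cong (_* jump G p c) (sym (constant c (subst (c ∈_) (sym eq) c∈)))) ⟩
        ∑ₗ (λ c → side c * jump G p c) cycleDarts ≡⟨ ∑-side ⟩
        0ℤ                                        ∎)
        where
        sub : ∀ c → c ∈ d ∷ walkDarts G w → c ∈ cycleDarts
        sub c = subst (c ∈_) eq
        constant : ∀ c → c ∈ d ∷ walkDarts G w → side c ≡ side d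
        constant c (here refl) = refl
        constant c (there c∈)  = side-along w d-head (sub d (here refl)) (λ b → sub b ∘ there) c c∈
      ... | inj₁ side≡0 = contradiction side≡0 (side≢0 (subst (d ∈_) eq (here refl)))
      ... | inj₂ ∑≡0    = ∑≡0

-- Decomposition of closed walks into cycles and spurs.

module _ (G : Map) where

  open Map G
  open Step

  walkDarts-◅◅ : ∀ {u v w} (p : Walk G u v) (r : Walk G v w) →
                 walkDarts G (p ◅◅ r) ≡ walkDarts G p ++ walkDarts G r
  walkDarts-◅◅ ε       r = refl
  walkDarts-◅◅ (s ◅ p) r = cong (dart s ∷_) (walkDarts-◅◅ p r)

  -- The decomposition is an equation between lists of darts and not between walks: the sum `Q` and
  -- the length, which are all that is compared, depend only on the darts.
  record Repetition {B : Set} (k : Dart → B) {u v} (w : Walk G u v) : Set where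
    field
      {a b c d} : Vertex
      before    : Walk G u a
      first     : Step G a b
      between   : Walk G b c
      second    : Step G c d
      after     : Walk G d v
      same      : k (dart first) ≡ k (dart second)
      darts-≡   : walkDarts G w ≡
                  walkDarts G before ++ dart first ∷ walkDarts G between ++ dart second ∷ walkDarts G after

  module _ {B : Set} (_≟_ : DecidableEquality B) (k : Dart → B) where

    open DecMembership _≟_ using (_∈?_)

    repetition-◅ : ∀ {u v w} {s : Step G u v} {p : Walk G v w} → Repetition k p → Repetition k (s ◅ p)
    repetition-◅ {s = s} r = record
      { before = s ◅ before ; first = first ; between = between ; second = second ; after = after
      ; same = same ; darts-≡ = cong (dart s ∷_) darts-≡ }
      where open Repetition r

    repetition-here : ∀ {u v w} (s : Step G u v) (p : Walk G v w) →
                      k (dart s) ∈ map k (walkDarts G p) → Repetition k (s ◅ p)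
    repetition-here s (t ◅ p) (here eq) = record
      { before = ε ; first = s ; between = ε ; second = t ; after = p ; same = eq ; darts-≡ = refl }
    repetition-here s (t ◅ p) (there ∈p) = go (locate p ∈p)
      where
      Located : ∀ {v w} → Walk G v w → Set
      Located {v} {w} p = Σ[ c ∈ Vertex ] Σ[ d ∈ Vertex ] Σ[ m ∈ Walk G v c ]
        Σ[ t ∈ Step G c d ] Σ[ r ∈ Walk G d w ]
        k (dart s) ≡ k (dart t) × walkDarts G p ≡ walkDarts G m ++ dart t ∷ walkDarts G r
      locate : ∀ {v w} (p : Walk G v w) → k (dart s) ∈ map k (walkDarts G p) → Located p
      locate (t ◅ p) (here eq)  = _ , _ , ε , t , p , eq , refl
      locate (t ◅ p) (there ∈p) =
        let _ , _ , m , t′ , r , same , eq = locate p ∈p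
        in _ , _ , t ◅ m , t′ , r , same , cong (dart t ∷_) eq
      go : Located p → Repetition k (s ◅ t ◅ p)
      go (_ , _ , m , t′ , r , same , eq) = record
        { before = ε ; first = s ; between = t ◅ m ; second = t′ ; after = r
        ; same = same ; darts-≡ = cong (λ xs → dart s ∷ dart t ∷ xs) eq }

    unique? : ∀ {u v} (w : Walk G u v) → Unique (map k (walkDarts G w)) ⊎ Repetition k w
    unique? ε       = inj₁ []
    unique? (s ◅ w) with k (dart s) ∈? map k (walkDarts G w) | unique? w
    ... | yes s∈ | _           = inj₂ (repetition-here s w s∈)
    ... | no  _  | inj₂ r      = inj₂ (repetition-◅ r)
    ... | no  s∉ | inj₁ unique = inj₁ (¬Any⇒All¬ _ s∉ ∷ unique)

  module Cocycle (q : Dart → ℤ) (q-rev : ∀ d → q (rev d) ≡ - q d)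
                 (q-cycle : ∀ C → ∑ₗ q (Cycle.cycleDarts {G} C) ≡ 0ℤ) where

    Q : ∀ {u v} → Walk G u v → ℤ
    Q w = ∑ₗ q (walkDarts G w)

    Q-◅◅ : ∀ {u v w} (p : Walk G u v) (r : Walk G v w) → Q (p ◅◅ r) ≡ Q p + Q r
    Q-◅◅ p r = trans (cong (∑ₗ q) (walkDarts-◅◅ p r)) (∑ₗ-++ q (walkDarts G p) (walkDarts G r))

    len : ∀ {u v} → Walk G u v → ℕ
    len w = length (walkDarts G w)

    len-◅◅ : ∀ {u v w} (p : Walk G u v) (r : Walk G v w) → len (p ◅◅ r) ≡ len p ℕ.+ len r
    len-◅◅ p r = trans (cong length (walkDarts-◅◅ p r)) (List.length-++ (walkDarts G p))

    module _ {B : Set} {k : Dart → B} {u v} {w : Walk G u v} (r : Repetition k w) where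

      open Repetition r

      Q-repetition : Q w ≡ Q before + (q (dart first) + (Q between + (q (dart second) + Q after)))
      Q-repetition = trans (cong (∑ₗ q) darts-≡) (trans (∑ₗ-++ q (walkDarts G before) _)
        (cong (λ i → Q before + (q (dart first) + i)) (∑ₗ-++ q (walkDarts G between) _)))

      len-repetition : len w ≡ len before ℕ.+ suc (len between ℕ.+ suc (len after))
      len-repetition = trans (cong length darts-≡) (trans (List.length-++ (walkDarts G before))
        (cong (λ l → len before ℕ.+ suc l) (List.length-++ (walkDarts G between))))

    mutual

      -- Induction on a strict bound `n` of the length. A repeated tail splits the walk into two
      -- shorter closed walks. An edge repeated in the same direction repeats a tail; repeated in
      -- opposite directions, its two contributions cancel and two shorter closed walks remain. A
      -- nonempty walk without either repetition is a cycle.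
      Q-closed : ∀ n {u} (w : Walk G u u) → len w < n → Q w ≡ 0ℤ
      Q-closed (suc n) ε       _       = refl
      Q-closed (suc n) w@(_ ◅ _) w<n with unique? V._≟_ tail w | unique? E._≟_ edge w
      ... | inj₂ r      | _          = Q-tail n w w<n r
      ... | inj₁ _      | inj₂ r     = Q-edge n w w<n r
      ... | inj₁ simple | inj₁ edges = q-cycle (record
        { walk = w ; nonempty = λ () ; simple = simple ; edge-simple = edges })

      Q-tail : ∀ n {u} (w : Walk G u u) → len w < suc n → Repetition tail w → Q w ≡ 0ℤ
      Q-tail n w w<n r@record
        { before = before ; first = first@(step _ refl _) ; between = between
        ; second = second@(step _ c≡ _) ; after = after ; same = same }
        with refl ← trans same c≡ = begin
        Q w
          ≡⟨ Q-repetition r ⟩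
        Q before + (q (dart first) + (Q between + (q (dart second) + Q after)))
          ≡⟨ rearrange (Q before) (q (dart first)) (Q between) (q (dart second) + Q after) ⟩
        (q (dart first) + Q between) + (Q before + (q (dart second) + Q after))
          ≡⟨ cong (_+_ (q (dart first) + Q between)) (sym (Q-◅◅ before (second ◅ after))) ⟩
        Q (first ◅ between) + Q (before ◅◅ second ◅ after)
          ≡⟨ cong₂ _+_ (Q-closed n (first ◅ between) (ℕ.<-≤-trans (shorter₁ _ _ _) bound))
               (Q-closed n (before ◅◅ second ◅ after) (ℕ.<-≤-trans
                 (ℕ.≤-<-trans (ℕ.≤-reflexive (len-◅◅ before (second ◅ after)))
                   (shorter₂ (len before) (len between) (len after))) bound)) ⟩
        0ℤ ∎
        where
        rearrange : ∀ a b c d → a + (b + (c + d)) ≡ (b + c) + (a + d)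
        rearrange = solve-∀
        bound : len before ℕ.+ suc (len between ℕ.+ suc (len after)) ≤ n
        bound = ℕ.≤-trans (ℕ.≤-reflexive (sym (len-repetition r))) (ℕ.≤-pred w<n)
        shorter₁ : ∀ a b c → suc b < a ℕ.+ suc (b ℕ.+ suc c)
        shorter₁ a b c = ℕ.≤-trans (s<s (ℕ.m<m+n b z<s)) (ℕ.m≤n+m _ a)
        shorter₂ : ∀ a b c → a ℕ.+ suc c < a ℕ.+ suc (b ℕ.+ suc c)
        shorter₂ a b c = ℕ.+-monoʳ-< a (s<s (ℕ.m≤n+m (suc c) b))

      Q-edge : ∀ n {u} (w : Walk G u u) → len w < suc n → Repetition edge w → Q w ≡ 0ℤ
      Q-edge n w w<n r with Bool._≟_ (proj₂ (dart (Repetition.first r))) (proj₂ (dart (Repetition.second r)))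
      ... | yes eq = Q-tail n w w<n (record
        { before = before ; first = first ; between = between ; second = second ; after = after
        ; same = cong tail (cong₂ _,_ same eq) ; darts-≡ = darts-≡ })
        where open Repetition r
      ... | no neq = Q-spur n w w<n r (cong₂ _,_ (sym (Repetition.same r)) (Bool.¬-not (neq ∘ sym)))

      Q-spur : ∀ n {u} (w : Walk G u u) → len w < suc n → (r : Repetition edge w) →
               dart (Repetition.second r) ≡ rev (dart (Repetition.first r)) → Q w ≡ 0ℤ
      Q-spur n w w<n r@record
        { before = before ; first = step x refl refl ; between = between
        ; second = step _ refl y-head ; after = after } refl
        -- The head of `rev x` is the tail of `x`, so `after` starts where `before` ends.
        with refl ← trans (cong tail (sym (rev-rev G x))) y-head = begin
        Q w
          ≡⟨ Q-repetition r ⟩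
        Q before + (q x + (Q between + (q (rev x) + Q after)))
          ≡⟨ cong (λ i → Q before + (q x + (Q between + (i + Q after)))) (q-rev x) ⟩
        Q before + (q x + (Q between + (- q x + Q after)))
          ≡⟨ rearrange (Q before) (q x) (Q between) (Q after) ⟩
        Q between + (Q before + Q after)
          ≡⟨ cong (_+_ (Q between)) (sym (Q-◅◅ before after)) ⟩
        Q between + Q (before ◅◅ after)
          ≡⟨ cong₂ _+_ (Q-closed n between (ℕ.<-≤-trans (shorter₁ (len before) (len between) (len after)) bound))
               (Q-closed n (before ◅◅ after) (ℕ.<-≤-trans
                 (ℕ.≤-<-trans (ℕ.≤-reflexive (len-◅◅ before after))
                   (shorter₂ (len before) (len between) (len after))) bound)) ⟩
        0ℤ ∎
        where
        rearrange : ∀ a b c d → a + (b + (c + (- b + d))) ≡ c + (a + d)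
        rearrange = solve-∀
        bound : len before ℕ.+ suc (len between ℕ.+ suc (len after)) ≤ n
        bound = ℕ.≤-trans (ℕ.≤-reflexive (sym (len-repetition r))) (ℕ.≤-pred w<n)
        shorter₁ : ∀ a b c → b < a ℕ.+ suc (b ℕ.+ suc c)
        shorter₁ a b c = ℕ.≤-trans (s<s (ℕ.m≤m+n b (suc c))) (ℕ.m≤n+m _ a)
        shorter₂ : ∀ a b c → a ℕ.+ c < a ℕ.+ suc (b ℕ.+ suc c)
        shorter₂ a b c = ℕ.+-monoʳ-< a (s<s (ℕ.≤-trans (ℕ.n≤1+n c) (ℕ.m≤n+m (suc c) b)))

    closed : ∀ {u} (w : Walk G u u) → Q w ≡ 0ℤ
    closed w = Q-closed (suc (len w)) w (ℕ.n<1+n (len w))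

    module _ (connected : ∀ u v → Walk G u v) (o : Vertex) where

      height : Vertex → ℤ
      height v = Q (connected o v)

      -- The chosen walk to the head of `d`, and the chosen walk to its tail followed by `d`, are
      -- closed up by the same `return`; both closed walks have sum 0.
      q-height : ∀ d → height (tail d) + q d ≡ height (head d)
      q-height d = +-cancelʳ (Q return) _ _ (begin
        height (tail d) + q d + Q return
          ≡⟨ ℤ.+-assoc (height (tail d)) (q d) (Q return) ⟩
        height (tail d) + (q d + Q return)
          ≡⟨ sym (Q-◅◅ (connected o (tail d)) (step d refl refl ◅ return)) ⟩
        Q (connected o (tail d) ◅◅ step d refl refl ◅ return)
          ≡⟨ trans (closed (connected o (tail d) ◅◅ step d refl refl ◅ return))
               (sym (closed (connected o (head d) ◅◅ return))) ⟩
        Q (connected o (head d) ◅◅ return)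
          ≡⟨ Q-◅◅ (connected o (head d)) return ⟩
        height (head d) + Q return ∎)
        where
        return = connected (head d) o

  -- Potentials on the edges.

  jump-rev : ∀ p d → jump G p (rev d) ≡ - jump G p d
  jump-rev p d = trans (cong (λ c → p (rev d) - p c) (rev-rev G d)) (flip (p (rev d)) (p d))
    where
    flip : ∀ a b → a - b ≡ - (b - a)
    flip = solve-∀

  -- Adding to `p` the height of the tail makes it agree on the two darts of every edge. Increments
  -- are unaffected, since rotation keeps the tail, and subtracting the value at `e₀` normalises the
  -- result.
  edge-potential : (connected : ∀ u v → Walk G u v) (e₀ : Edge) →
                   ∀ {z p} → IsIncrement G z p → (∀ C → ∑ₗ (jump G p) (Cycle.cycleDarts {G} C) ≡ 0ℤ) →
                   Σ[ μ ∈ (Edge → ℤ) ] μ e₀ ≡ 0ℤ × IsIncrement G z (μ ∘ edge)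
  edge-potential connected e₀ {z} {p} inc p-cycle = μ , ℤ.+-inverseʳ (λ′ (e₀ , true)) , μ-increment
    where
    open Cocycle (jump G p) (jump-rev p) p-cycle
    h = height connected (tail (e₀ , true))
    λ′ : Dart → ℤ
    λ′ d = p d + h (tail d)
    λ′-rev : ∀ d → λ′ (rev d) ≡ λ′ d
    λ′-rev d = trans (cong (_+_ (p (rev d))) (sym (q-height connected _ d)))
      (rearrange (p (rev d)) (h (tail d)) (p d))
      where
      rearrange : ∀ a b c → a + (b + (c - a)) ≡ c + b
      rearrange = solve-∀
    μ : Edge → ℤ
    μ e = λ′ (e , true) - λ′ (e₀ , true)
    μ-edge : ∀ d → μ (edge d) ≡ λ′ d - λ′ (e₀ , true)
    μ-edge (e , true)  = refl
    μ-edge (e , false) = cong (_- λ′ (e₀ , true)) (λ′-rev (e , false))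
    μ-increment : IsIncrement G z (μ ∘ edge)
    μ-increment d = begin
      z d
        ≡⟨ inc d ⟩
      p (σ d) - p d
        ≡⟨ rearrange (p (σ d)) (p d) (h (tail d)) (λ′ (e₀ , true)) ⟩
      (p (σ d) + h (tail d) - λ′ (e₀ , true)) - (λ′ d - λ′ (e₀ , true))
        ≡⟨ cong (λ v → (p (σ d) + h v - λ′ (e₀ , true)) - (λ′ d - λ′ (e₀ , true))) (sym (tail-σ d)) ⟩
      (λ′ (σ d) - λ′ (e₀ , true)) - (λ′ d - λ′ (e₀ , true))
        ≡⟨ sym (cong₂ _-_ (μ-edge (σ d)) (μ-edge d)) ⟩
      μ (edge (σ d)) - μ (edge d) ∎
      where
      rearrange : ∀ a b c e → a - b ≡ (a + c - e) - (b + c - e)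
      rearrange = solve-∀

  -- The difference `δ` is constant on the edges around each vertex, hence along every walk from an
  -- end of `e₀` to an end of `e`.
  edge-potential-unique : (∀ u v → Walk G u v) → ∀ e₀ {z μ ν} →
                          IsIncrement G z (μ ∘ edge) → IsIncrement G z (ν ∘ edge) →
                          μ e₀ ≡ ν e₀ → ∀ e → μ e ≡ ν e
  edge-potential-unique connected e₀ {z} {μ} {ν} μ-inc ν-inc eq e =
    ℤ.i-j≡0⇒i≡j (μ e) (ν e) (trans
      (sym (δ-walk (connected (tail d₀) (tail d)) d₀ d refl refl))
      (ℤ.i≡j⇒i-j≡0 eq))
    where
    d₀ d : Dart
    d₀ = e₀ , true
    d = e , true
    δ : Edge → ℤ
    δ e = μ e - ν e
    δ-σ : ∀ c → δ (edge (σ c)) ≡ δ (edge c)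
    δ-σ c = ℤ.i-j≡0⇒i≡j _ _ (trans
      (rearrange (μ (edge (σ c))) (ν (edge (σ c))) (μ (edge c)) (ν (edge c)))
      (ℤ.i≡j⇒i-j≡0 (trans (sym (μ-inc c)) (ν-inc c))))
      where
      rearrange : ∀ a b c d → (a - b) - (c - d) ≡ (a - c) - (b - d)
      rearrange = solve-∀
    δ-iter : ∀ k c → δ (edge (iter σ k c)) ≡ δ (edge c)
    δ-iter zero    c = refl
    δ-iter (suc k) c = trans (δ-σ (iter σ k c)) (δ-iter k c)
    δ-tail : ∀ b c → tail b ≡ tail c → δ (edge b) ≡ δ (edge c)
    δ-tail b c eq with k , refl ← iter-orbit G b c eq = sym (δ-iter k b)
    δ-walk : ∀ {u v} (w : Walk G u v) b c → tail b ≡ u → tail c ≡ v → δ (edge b) ≡ δ (edge c)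
    δ-walk ε                         b c b-tail c-tail = δ-tail b c (trans b-tail (sym c-tail))
    δ-walk (step s s-tail s-head ◅ w) b c b-tail c-tail = trans
      (δ-tail b s (trans b-tail (sym s-tail))) (δ-walk w (rev s) c s-head c-tail)

-- Clipping potentials at zero.

-- Integers that differ by at most 1 cannot have strictly opposite signs.
same-sign : ∀ b c x y → ⟦ b ⟧ - ⟦ c ⟧ ≡ x - y → (x ℤ.≤ 0ℤ × y ℤ.≤ 0ℤ) ⊎ (0ℤ ℤ.≤ x × 0ℤ ℤ.≤ y)
same-sign b c (+ m)     (+ n)     _  = inj₂ (+≤+ z≤n , +≤+ z≤n)
same-sign b c (+ zero)  -[1+ n ]  _  = inj₁ (ℤ.≤-refl , -≤+)
same-sign b c (-[1+ m ]) (+ zero) _  = inj₁ (-≤+ , ℤ.≤-refl)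
same-sign b c (-[1+ m ]) -[1+ n ] _  = inj₁ (-≤+ , -≤+)
-- Here `x - y` is `m + n + 2`, out of reach for a difference of two bits; the rewriting brings both
-- successors to the front.
same-sign b c (+ suc m) -[1+ n ]  eq rewrite ℕ.+-suc m n with b | c
... | true  | true  = contradiction eq λ ()
... | true  | false = contradiction eq λ ()
... | false | true  = contradiction eq λ ()
... | false | false = contradiction eq λ ()
same-sign b c -[1+ m ] (+ suc n)  eq with b | c
... | true  | true  = contradiction eq λ ()
... | true  | false = contradiction eq λ ()
... | false | true  = contradiction eq λ ()
... | false | false = contradiction eq λ ()

-- Since `x` and `y` lie weakly on the same side of 0, clipping either annihilates their difference,
-- which `b` realises, or keeps it, which `c` realises. So clipped potentials still come from
-- orientations.
interpolate-⊔ : ∀ b c x y → ⟦ b ⟧ - ⟦ c ⟧ ≡ x - y → ∃[ a ] ⟦ b ⟧ - ⟦ a ⟧ ≡ (x ⊔ 0ℤ) - (y ⊔ 0ℤ)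
interpolate-⊔ b c x y eq with same-sign b c x y eq
... | inj₁ (x≤0 , y≤0) = b , trans (ℤ.+-inverseʳ ⟦ b ⟧) (sym (cong₂ _-_ (ℤ.i≤j⇒i⊔j≡j x≤0) (ℤ.i≤j⇒i⊔j≡j y≤0)))
... | inj₂ (0≤x , 0≤y) = c , trans eq (sym (cong₂ _-_ (ℤ.i≥j⇒i⊔j≡i 0≤x) (ℤ.i≥j⇒i⊔j≡i 0≤y)))

interpolate-⊓ : ∀ b c x y → ⟦ b ⟧ - ⟦ c ⟧ ≡ x - y → ∃[ a ] ⟦ b ⟧ - ⟦ a ⟧ ≡ (x ⊓ 0ℤ) - (y ⊓ 0ℤ)
interpolate-⊓ b c x y eq with same-sign b c x y eq
... | inj₁ (x≤0 , y≤0) = c , trans eq (sym (cong₂ _-_ (ℤ.i≤j⇒i⊓j≡i x≤0) (ℤ.i≤j⇒i⊓j≡i y≤0)))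
... | inj₂ (0≤x , 0≤y) = b , trans (ℤ.+-inverseʳ ⟦ b ⟧) (sym (cong₂ _-_ (ℤ.i≥j⇒i⊓j≡j 0≤x) (ℤ.i≥j⇒i⊓j≡j 0≤y)))

2*i≡0⇒i≡0 : ∀ i → + 2 * i ≡ 0ℤ → i ≡ 0ℤ
2*i≡0⇒i≡0 i eq with ℤ.i*j≡0⇒i≡0∨j≡0 (+ 2) eq
... | inj₂ i≡0 = i≡0

does-≟true : ∀ b → does (b Bool.≟ true) ≡ b
does-≟true true  = refl
does-≟true false = refl

does-≟false : ∀ b → does (b Bool.≟ false) ≡ not b
does-≟false true  = refl
does-≟false false = refl

-- Outdegrees in the angle map and balanced 4-orientations.

module _ (G : Map) where

  open Map G
  open Summation darts using (∑-cong; ∑--; ∑-permute)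

  private
    A : Map
    A = angleMap G
    module A = Map A

  outdegree-∑ : ∀ D x → + outdegree A D x ≡ D.∑ (λ a →
    ⟦ does (inj₁ (tail a) A.V.≟ x) ⟧ * ⟦ D a ⟧ + ⟦ does (inj₂ (left a) A.V.≟ x) ⟧ * ⟦ not (D a) ⟧)
  outdegree-∑ D x = begin
    + outdegree A D x
      ≡⟨ Summation.+count A.darts (λ c → (A.tail c A.V.≟ x) ×-dec directed? A D c) ⟩
    A.D.∑ (λ c → ⟦ does (A.tail c A.V.≟ x) Bool.∧ does (directed? A D c) ⟧)
      ≡⟨ ∑-darts A (λ c → ⟦ does (A.tail c A.V.≟ x) Bool.∧ does (directed? A D c) ⟧) ⟩
    D.∑ (λ a → ⟦ does (inj₁ (tail a) A.V.≟ x) Bool.∧ does (D a Bool.≟ true) ⟧ +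
               ⟦ does (inj₂ (left a) A.V.≟ x) Bool.∧ does (D a Bool.≟ false) ⟧)
      ≡⟨ ∑-cong (λ a → cong₂ _+_
           (trans (⟦∧⟧ (does (inj₁ (tail a) A.V.≟ x)) _)
             (cong (λ b → ⟦ does (inj₁ (tail a) A.V.≟ x) ⟧ * ⟦ b ⟧) (does-≟true (D a))))
           (trans (⟦∧⟧ (does (inj₂ (left a) A.V.≟ x)) _)
             (cong (λ b → ⟦ does (inj₂ (left a) A.V.≟ x) ⟧ * ⟦ b ⟧) (does-≟false (D a))))) ⟩
    D.∑ (λ a → ⟦ does (inj₁ (tail a) A.V.≟ x) ⟧ * ⟦ D a ⟧ +
               ⟦ does (inj₂ (left a) A.V.≟ x) ⟧ * ⟦ not (D a) ⟧) ∎

  outdegree-primal : ∀ D v → + outdegree A D (inj₁ v) ≡ D.∑ (λ a → atTail G v a * ⟦ D a ⟧)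
  outdegree-primal D v = trans (outdegree-∑ D (inj₁ v)) (∑-cong λ a → trans
    (cong₂ (λ b c → ⟦ b ⟧ * ⟦ D a ⟧ + ⟦ c ⟧ * ⟦ not (D a) ⟧)
      (does-⇔ (mk⇔ Sum.inj₁-injective (cong inj₁)) (inj₁ (tail a) A.V.≟ inj₁ v) (tail a V.≟ v))
      (dec-false (inj₂ (left a) A.V.≟ inj₁ v) λ ()))
    (ℤ.+-identityʳ (atTail G v a * ⟦ D a ⟧)))

  outdegree-dual : ∀ D f → + outdegree A D (inj₂ f) ≡ D.∑ (λ a → atFace G f a * ⟦ not (D a) ⟧)
  outdegree-dual D f = trans (outdegree-∑ D (inj₂ f)) (∑-cong λ a → trans
    (cong₂ (λ b c → ⟦ b ⟧ * ⟦ D a ⟧ + ⟦ c ⟧ * ⟦ not (D a) ⟧)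
      (dec-false (inj₁ (tail a) A.V.≟ inj₂ f) λ ())
      (does-⇔ (mk⇔ Sum.inj₂-injective (cong inj₂)) (inj₂ (left a) A.V.≟ inj₂ f) (left a F.≟ f)))
    (ℤ.+-identityˡ (atFace G f a * ⟦ not (D a) ⟧)))

  outdegree-primal-change : ∀ D D′ v → + outdegree A D (inj₁ v) - + outdegree A D′ (inj₁ v) ≡
                            D.∑ (λ a → atTail G v a * change G D D′ a)
  outdegree-primal-change D D′ v = begin
    + outdegree A D (inj₁ v) - + outdegree A D′ (inj₁ v)
      ≡⟨ cong₂ _-_ (outdegree-primal D v) (outdegree-primal D′ v) ⟩
    D.∑ (λ a → atTail G v a * ⟦ D a ⟧) - D.∑ (λ a → atTail G v a * ⟦ D′ a ⟧)
      ≡⟨ sym (∑-- (λ a → atTail G v a * ⟦ D a ⟧) (λ a → atTail G v a * ⟦ D′ a ⟧)) ⟩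
    D.∑ (λ a → atTail G v a * ⟦ D a ⟧ - atTail G v a * ⟦ D′ a ⟧)
      ≡⟨ ∑-cong (λ a → factor (atTail G v a) ⟦ D a ⟧ ⟦ D′ a ⟧) ⟩
    D.∑ (λ a → atTail G v a * change G D D′ a) ∎
    where
    factor : ∀ a b c → a * b - a * c ≡ a * (b - c)
    factor = solve-∀

  -- Compared with primal vertices, `D` and `D′` trade places on the left, because an angle leaves
  -- its dual vertex when its bit is `false`.
  outdegree-dual-change : ∀ D D′ f → + outdegree A D′ (inj₂ f) - + outdegree A D (inj₂ f) ≡
                          D.∑ (λ a → atFace G f a * change G D D′ a)
  outdegree-dual-change D D′ f = begin
    + outdegree A D′ (inj₂ f) - + outdegree A D (inj₂ f)
      ≡⟨ cong₂ _-_ (outdegree-dual D′ f) (outdegree-dual D f) ⟩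
    D.∑ (λ a → atFace G f a * ⟦ not (D′ a) ⟧) - D.∑ (λ a → atFace G f a * ⟦ not (D a) ⟧)
      ≡⟨ sym (∑-- (λ a → atFace G f a * ⟦ not (D′ a) ⟧) (λ a → atFace G f a * ⟦ not (D a) ⟧)) ⟩
    D.∑ (λ a → atFace G f a * ⟦ not (D′ a) ⟧ - atFace G f a * ⟦ not (D a) ⟧)
      ≡⟨ ∑-cong (λ a → trans
           (cong₂ (λ i j → atFace G f a * i - atFace G f a * j) (⟦not⟧ (D′ a)) (⟦not⟧ (D a)))
           (factor (atFace G f a) ⟦ D a ⟧ ⟦ D′ a ⟧)) ⟩
    D.∑ (λ a → atFace G f a * change G D D′ a) ∎
    where
    factor : ∀ a b c → a * (1ℤ - c) - a * (1ℤ - b) ≡ a * (b - c)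
    factor = solve-∀

  ∑-telescope : (π : Dart ↔ Dart) (w m : Dart → ℤ) → (∀ d → w (Inverse.to π d) ≡ w d) →
                D.∑ (λ d → w d * (m (Inverse.to π d) - m d)) ≡ 0ℤ
  ∑-telescope π w m w-inv = begin
    D.∑ (λ d → w d * (m (to d) - m d))
      ≡⟨ ∑-cong (λ d → trans (expand (w d) (m (to d)) (m d)) (cong (λ i → i * m (to d) - w d * m d) (sym (w-inv d)))) ⟩
    D.∑ (λ d → w (to d) * m (to d) - w d * m d)
      ≡⟨ ∑-- (λ d → w (to d) * m (to d)) (λ d → w d * m d) ⟩
    D.∑ (λ d → w (to d) * m (to d)) - D.∑ (λ d → w d * m d)
      ≡⟨ ℤ.i≡j⇒i-j≡0 (∑-permute π (λ d → w d * m d)) ⟩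
    0ℤ ∎
    where
    open Inverse π using (to)
    expand : ∀ a b c → a * (b - c) ≡ a * b - a * c
    expand = solve-∀

  reversal : Dart ↔ Dart
  reversal = mk↔ₛ′ rev rev (rev-rev G) (rev-rev G)

  open BalancedFourOrientation
  open IsFourOrientation

  module _ (B B′ : BalancedFourOrientation G) where

    private
      D  = orientation B
      D′ = orientation B′
      z  = change G D D′

    change-tail : ∀ v → D.∑ (λ a → atTail G v a * z a) ≡ 0ℤ
    change-tail v = trans (sym (outdegree-primal-change D D′ v))
      (ℤ.i≡j⇒i-j≡0 (cong +_ (trans (primal (isFourOrientation B) v) (sym (primal (isFourOrientation B′) v)))))

    change-left : ∀ f → D.∑ (λ a → atFace G f a * z a) ≡ 0ℤ
    change-left f = trans (sym (outdegree-dual-change D D′ f))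
      (ℤ.i≡j⇒i-j≡0 (cong +_ (trans (dual (isFourOrientation B′) f) (sym (dual (isFourOrientation B) f)))))

    -- Contractibility need not be decided, since equality in ℤ is stable.
    ∑-jump-cycle : ∀ p → IsIncrement G z p → ∀ C → ∑ₗ (jump G p) (Cycle.cycleDarts {G} C) ≡ 0ℤ
    ∑-jump-cycle p inc C = decidable-stable (K ℤ.≟ 0ℤ) λ K≢0 → K≢0 (balanced λ disk →
      K≢0 (Boundary.∑-jump≡0 G C disk {z} {p} inc change-left))
      where
      K = ∑ₗ (jump G p) (Cycle.cycleDarts {G} C)
      balanced : ¬ Contractible G C → K ≡ 0ℤ
      balanced ¬disk = 2*i≡0⇒i≡0 K (trans
        (sym (γ-change G {D} {D′} {p} inc C))
        (cong₂ _-_ (isBalanced B C ¬disk) (isBalanced B′ C ¬disk)))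

    module _ (connected : ∀ u v → Walk G u v) (e₀ : Edge) where

      balanced-potential : Σ[ μ ∈ (Edge → ℤ) ] μ e₀ ≡ 0ℤ × IsIncrement G z (μ ∘ edge)
      balanced-potential = edge-potential G connected e₀ {z} {p} inc (∑-jump-cycle p inc)
        where
        p = LocalPotential.potential G z change-tail
        inc : IsIncrement G z p
        inc = LocalPotential.potential-increment G z change-tail

  -- The increments of `μ` telescope around vertices and around faces, which keeps the outdegrees,
  -- and `μ ∘ edge` has no jumps, which keeps γ.
  transfer : (B : BalancedFourOrientation G) (D : Orientation A) (μ : Edge → ℤ) →
             IsIncrement G (change G (orientation B) D) (μ ∘ edge) → BalancedFourOrientation G
  transfer B D μ inc = record
    { orientation = D
    ; isFourOrientation = record
      { primal = λ v → trans (sym (same-primal v)) (primal (isFourOrientation B) v)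
      ; dual   = λ f → trans (same-dual f) (dual (isFourOrientation B) f)
      }
    ; isBalanced = λ C ¬disk → trans (sym (same-γ C)) (isBalanced B C ¬disk)
    }
    where
    D₀ = orientation B
    same-primal : ∀ v → outdegree A D₀ (inj₁ v) ≡ outdegree A D (inj₁ v)
    same-primal v = ℤ.+-injective (ℤ.i-j≡0⇒i≡j _ _ (begin
      + outdegree A D₀ (inj₁ v) - + outdegree A D (inj₁ v)
        ≡⟨ outdegree-primal-change D₀ D v ⟩
      D.∑ (λ a → atTail G v a * change G D₀ D a)
        ≡⟨ ∑-cong (λ a → cong (atTail G v a *_) (inc a)) ⟩
      D.∑ (λ a → atTail G v a * (μ (edge (σ a)) - μ (edge a)))
        ≡⟨ ∑-telescope rotation (atTail G v) (μ ∘ edge) (λ a → cong (λ u → ⟦ does (u V.≟ v) ⟧) (tail-σ a)) ⟩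
      0ℤ ∎))
    same-dual : ∀ f → outdegree A D (inj₂ f) ≡ outdegree A D₀ (inj₂ f)
    same-dual f = ℤ.+-injective (ℤ.i-j≡0⇒i≡j _ _ (begin
      + outdegree A D (inj₂ f) - + outdegree A D₀ (inj₂ f)
        ≡⟨ outdegree-dual-change D₀ D f ⟩
      D.∑ (λ a → atFace G f a * change G D₀ D a)
        ≡⟨ ∑-cong (λ a → cong (atFace G f a *_) (inc a)) ⟩
      D.∑ (λ a → atFace G f a * (μ (edge (σ a)) - μ (edge a)))
        -- The permutation `rev ∘ σ`, inverse to `φ`, steps around the face; `μ ∘ edge` does not
        -- distinguish `rev (σ a)` from `σ a`.
        ≡⟨ ∑-telescope (reversal ↔-∘ rotation) (atFace G f) (μ ∘ edge)
             (λ a → cong (λ g → ⟦ does (g F.≟ f) ⟧) (left-rev-σ G a)) ⟩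
      0ℤ ∎))
    same-γ : ∀ C → γ G D₀ C ≡ γ G D C
    same-γ C = ℤ.i-j≡0⇒i≡j _ _ (trans (γ-change G {D₀} {D} {μ ∘ edge} inc C)
      (cong (+ 2 *_) (∑ₗ-zero (Cycle.cycleDarts C) (λ d _ → ℤ.+-inverseʳ (μ (edge d))))))

-- The order in terms of face coefficients.

sign : Bool → ℤ
sign true  = 1ℤ
sign false = ℤ.-1ℤ

sign-cancel : ∀ b {i j} → sign b * i ≡ sign b * j → i ≡ j
sign-cancel true  eq = ℤ.*-cancelˡ-≡ 1ℤ _ _ eq
sign-cancel false eq = ℤ.*-cancelˡ-≡ ℤ.-1ℤ _ _ eq

module _ (M : Map) where

  open Map M

  flow-difference : ∀ R D D′ e →
    characteristicFlow M R (difference M D D′) e ≡ sign (R e) * (⟦ D e ⟧ - ⟦ D′ e ⟧)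
  flow-difference R D D′ e with R e | D e | D′ e
  ... | true  | true  | true  = refl
  ... | true  | true  | false = refl
  ... | true  | false | true  = refl
  ... | true  | false | false = refl
  ... | false | true  | true  = refl
  ... | false | true  | false = refl
  ... | false | false | true  = refl
  ... | false | false | false = refl

  flow-faces : ∀ R (m : Face → ℕ) e →
    F.∑ (λ f → + m f * characteristicFlow M R (facialWalk M f) e) ≡
    sign (R e) * (+ m (left (e , true)) - + m (left (e , false)))
  flow-faces R m e = begin
    F.∑ (λ f → + m f * characteristicFlow M R (facialWalk M f) e)
      ≡⟨ ∑-cong (λ f → trans (cong (+ m f *_)
             (sym (ℤ.m-n≡m⊖n (facialWalk M f (e , R e)) (facialWalk M f (e , not (R e))))))
           (distrib (+ m f) (on (e , R e) f) (on (e , not (R e)) f))) ⟩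
    F.∑ (λ f → on (e , R e) f * + m f - on (e , not (R e)) f * + m f)
      ≡⟨ ∑-- (λ f → on (e , R e) f * + m f) (λ f → on (e , not (R e)) f * + m f) ⟩
    F.∑ (λ f → on (e , R e) f * + m f) - F.∑ (λ f → on (e , not (R e)) f * + m f)
      ≡⟨ cong₂ _-_ (∑-select (left (e , R e)) (λ f → + m f)) (∑-select (left (e , not (R e))) (λ f → + m f)) ⟩
    + m (left (e , R e)) - + m (left (e , not (R e)))
      ≡⟨ signed (R e) ⟩
    sign (R e) * (+ m (left (e , true)) - + m (left (e , false))) ∎
    where
    open Summation faces
    on : Dart → Face → ℤ
    on d f = ⟦ does (left d F.≟ f) ⟧
    distrib : ∀ a b c → a * (b - c) ≡ b * a - c * a
    distrib = solve-∀
    flip : ∀ a b → a - b ≡ ℤ.-1ℤ * (b - a)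
    flip = solve-∀
    signed : ∀ b → + m (left (e , b)) - + m (left (e , not b)) ≡
                   sign b * (+ m (left (e , true)) - + m (left (e , false)))
    signed true  = sym (ℤ.*-identityˡ _)
    signed false = flip (+ m (left (e , false))) (+ m (left (e , true)))

  -- Both flows carry the factor `sign (R e)`, so the reference orientation cancels; of the facial
  -- walks only those of the two faces beside `e` contribute.
  below-≡ : ∀ R D D′ (m : Face → ℕ) e →
    (characteristicFlow M R (difference M D D′) e ≡ F.∑ (λ f → + m f * characteristicFlow M R (facialWalk M f) e)) ⇔
    (⟦ D e ⟧ - ⟦ D′ e ⟧ ≡ + m (left (e , true)) - + m (left (e , false)))
  below-≡ R D D′ m e = mk⇔
    (λ eq → sign-cancel (R e) (trans (sym (flow-difference R D D′ e)) (trans eq (flow-faces R m e))))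
    (λ eq → trans (flow-difference R D D′ e) (trans (cong (sign (R e) *_) eq) (sym (flow-faces R m e))))

-- The lattice of balanced 4-orientations.

module BalancedLattice (G : Map) (connected : ∀ u v → Walk G u v)
                       (R : Orientation (angleMap G)) (f₀ : Map.Edge G) where

  open Map G
  open BalancedFourOrientation

  Balanced : Set
  Balanced = BalancedFourOrientation G

  _≈_ _≼_ : Balanced → Balanced → Set
  _≈_ = _≈ᴮ_ G
  _≼_ = BalancedBelow G R f₀

  Δ : Balanced → Balanced → Dart → ℤ
  Δ B B′ = change G (orientation B) (orientation B′)

  -- The coefficients λ of the order, without the requirement of being
  -- nonnegative.
  pot : Balanced → Balanced → Edge → ℤ
  pot B B′ = proj₁ (balanced-potential G B B′ connected f₀)

  pot-f₀ : ∀ B B′ → pot B B′ f₀ ≡ 0ℤ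
  pot-f₀ B B′ = proj₁ (proj₂ (balanced-potential G B B′ connected f₀))

  pot-increment : ∀ B B′ → IsIncrement G (Δ B B′) (pot B B′ ∘ edge)
  pot-increment B B′ = proj₂ (proj₂ (balanced-potential G B B′ connected f₀))

  pot-unique : ∀ B B′ μ → IsIncrement G (Δ B B′) (μ ∘ edge) → μ f₀ ≡ 0ℤ → ∀ e → pot B B′ e ≡ μ e
  pot-unique B B′ μ inc μ-f₀ = edge-potential-unique G connected f₀ {Δ B B′} {pot B B′} {μ}
    (pot-increment B B′) inc (trans (pot-f₀ B B′) (sym μ-f₀))

  -- The sum on the right has the required increments and vanishes at `f₀`, so uniqueness applies.
  -- This allows potentials to be compared from any common base.
  pot-+ : ∀ B B′ B″ e → pot B B″ e ≡ pot B B′ e + pot B′ B″ e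
  pot-+ B B′ B″ = pot-unique B B″ (λ e → pot B B′ e + pot B′ B″ e)
    (λ d → begin
      Δ B B″ d
        ≡⟨ insert ⟦ orientation B d ⟧ ⟦ orientation B′ d ⟧ ⟦ orientation B″ d ⟧ ⟩
      Δ B B′ d + Δ B′ B″ d
        ≡⟨ cong₂ _+_ (pot-increment B B′ d) (pot-increment B′ B″ d) ⟩
      (pot B B′ (edge (σ d)) - pot B B′ (edge d)) + (pot B′ B″ (edge (σ d)) - pot B′ B″ (edge d))
        ≡⟨ regroup (pot B B′ (edge (σ d))) (pot B B′ (edge d)) (pot B′ B″ (edge (σ d))) (pot B′ B″ (edge d)) ⟩
      (pot B B′ (edge (σ d)) + pot B′ B″ (edge (σ d))) - (pot B B′ (edge d) + pot B′ B″ (edge d)) ∎)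
    (cong₂ _+_ (pot-f₀ B B′) (pot-f₀ B′ B″))
    where
    insert : ∀ a b c → a - c ≡ (a - b) + (b - c)
    insert = solve-∀
    regroup : ∀ a b c d → (a - b) + (c - d) ≡ (a + c) - (b + d)
    regroup = solve-∀

  ≼⇒0≤pot : ∀ B B′ → B ≼ B′ → ∀ e → 0ℤ ℤ.≤ pot B B′ e
  ≼⇒0≤pot B B′ (m , m-f₀ , eq) e = subst (0ℤ ℤ.≤_) (sym (pot-unique B B′ (λ e → + m e)
    -- In the angle map the faces on the two sides of the angle `d` are the edges of `σ d` and of
    -- `d`, so the equation is already an increment condition.
    (λ d → Equivalence.to (below-≡ (angleMap G) R (orientation B) (orientation B′) m d) (eq d))
    (cong +_ m-f₀) e)) (+≤+ z≤n)

  0≤pot⇒≼ : ∀ B B′ → (∀ e → 0ℤ ℤ.≤ pot B B′ e) → B ≼ B′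
  0≤pot⇒≼ B B′ 0≤pot = (λ e → ℤ.∣ pot B B′ e ∣) , cong ℤ.∣_∣ (pot-f₀ B B′) , λ d →
    Equivalence.from (below-≡ (angleMap G) R (orientation B) (orientation B′) (λ e → ℤ.∣ pot B B′ e ∣) d)
      (trans (pot-increment B B′ d) (sym (cong₂ _-_
        (ℤ.0≤i⇒+∣i∣≡i (0≤pot (edge (σ d)))) (ℤ.0≤i⇒+∣i∣≡i (0≤pot (edge d))))))

  module _ (B₀ : Balanced) where

    -- By additivity `pot B B′` is the difference of the potentials based at `B₀`. Together with the
    -- next three lemmas this makes `pot B₀` an embedding of the order into the pointwise order on
    -- integer functions of the edges.
    ≼⇒≤ : ∀ B B′ → B ≼ B′ → ∀ e → pot B₀ B e ℤ.≤ pot B₀ B′ e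
    ≼⇒≤ B B′ B≼B′ e = subst₂ ℤ._≤_ (ℤ.+-identityʳ (pot B₀ B e)) (sym (pot-+ B₀ B B′ e))
      (ℤ.+-monoʳ-≤ (pot B₀ B e) (≼⇒0≤pot B B′ B≼B′ e))

    ≤⇒≼ : ∀ B B′ → (∀ e → pot B₀ B e ℤ.≤ pot B₀ B′ e) → B ≼ B′
    ≤⇒≼ B B′ le = 0≤pot⇒≼ B B′ λ e → subst (0ℤ ℤ.≤_) (difference-≡ e) (ℤ.i≤j⇒0≤j-i (le e))
      where
      cancel : ∀ a b → a + b - a ≡ b
      cancel = solve-∀
      difference-≡ : ∀ e → pot B₀ B′ e - pot B₀ B e ≡ pot B B′ e
      difference-≡ e = trans (cong (_- pot B₀ B e) (pot-+ B₀ B B′ e)) (cancel (pot B₀ B e) (pot B B′ e))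

    ≈⇒≡ : ∀ B B′ → B ≈ B′ → ∀ e → pot B₀ B e ≡ pot B₀ B′ e
    ≈⇒≡ B B′ B≈B′ = pot-unique B₀ B (pot B₀ B′)
      (λ d → trans (cong (λ b → ⟦ orientation B₀ d ⟧ - ⟦ b ⟧) (B≈B′ d)) (pot-increment B₀ B′ d))
      (pot-f₀ B₀ B′)

    ≡⇒≈ : ∀ B B′ → (∀ e → pot B₀ B e ≡ pot B₀ B′ e) → B ≈ B′
    ≡⇒≈ B B′ eq d = ⟦⟧-injective (ℤ.neg-injective (+-cancelˡ ⟦ orientation B₀ d ⟧ _ _ (begin
      Δ B₀ B d                                    ≡⟨ pot-increment B₀ B d ⟩
      pot B₀ B (edge (σ d)) - pot B₀ B (edge d)   ≡⟨ cong₂ _-_ (eq (edge (σ d))) (eq (edge d)) ⟩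
      pot B₀ B′ (edge (σ d)) - pot B₀ B′ (edge d) ≡⟨ sym (pot-increment B₀ B′ d) ⟩
      Δ B₀ B′ d                                   ∎)))

  module _ (B B′ : Balanced) where

    private
      μ = pot B B′
      join-at : ∀ d → ∃[ a ] ⟦ orientation B d ⟧ - ⟦ a ⟧ ≡ (μ (edge (σ d)) ⊔ 0ℤ) - (μ (edge d) ⊔ 0ℤ)
      join-at d = interpolate-⊔ (orientation B d) (orientation B′ d)
        (μ (edge (σ d))) (μ (edge d)) (pot-increment B B′ d)
      meet-at : ∀ d → ∃[ a ] ⟦ orientation B d ⟧ - ⟦ a ⟧ ≡ (μ (edge (σ d)) ⊓ 0ℤ) - (μ (edge d) ⊓ 0ℤ)
      meet-at d = interpolate-⊓ (orientation B d) (orientation B′ d)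
        (μ (edge (σ d))) (μ (edge d)) (pot-increment B B′ d)

    -- Based at `B`, the potential of `B` is 0 and that of `B′` is `μ`, so the pointwise maximum and
    -- minimum are the two clippings of `μ` at 0.
    _∨_ _∧_ : Balanced
    _∨_  = transfer G B (proj₁ ∘ join-at) (λ e → μ e ⊔ 0ℤ) (proj₂ ∘ join-at)
    _∧_ = transfer G B (proj₁ ∘ meet-at) (λ e → μ e ⊓ 0ℤ) (proj₂ ∘ meet-at)

    private
      pot-join : ∀ e → pot B _∨_ e ≡ μ e ⊔ 0ℤ
      pot-join = pot-unique B _∨_ (λ e → μ e ⊔ 0ℤ) (proj₂ ∘ join-at) (cong (_⊔ 0ℤ) (pot-f₀ B B′))
      pot-meet : ∀ e → pot B _∧_ e ≡ μ e ⊓ 0ℤ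
      pot-meet = pot-unique B _∧_ (λ e → μ e ⊓ 0ℤ) (proj₂ ∘ meet-at) (cong (_⊓ 0ℤ) (pot-f₀ B B′))

    -- Changing the base from `B` to `B₀` translates by `h`, and translation commutes with the
    -- maximum. The asymmetry between `B` and `B′` in the construction disappears.
    pot-∨ : ∀ B₀ e → pot B₀ _∨_ e ≡ pot B₀ B e ⊔ pot B₀ B′ e
    pot-∨ B₀ e = begin
      pot B₀ _∨_ e                            ≡⟨ pot-+ B₀ B _∨_ e ⟩
      h + pot B _∨_ e                         ≡⟨ cong (_+_ h) (trans (pot-join e) (ℤ.⊔-comm (μ e) 0ℤ)) ⟩
      h + (0ℤ ⊔ μ e)                          ≡⟨ ℤ.mono-≤-distrib-⊔ (ℤ.+-monoʳ-≤ h) 0ℤ (μ e) ⟩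
      (h + 0ℤ) ⊔ (h + μ e)                    ≡⟨ cong₂ _⊔_ (ℤ.+-identityʳ h) (sym (pot-+ B₀ B B′ e)) ⟩
      h ⊔ pot B₀ B′ e                         ∎
      where h = pot B₀ B e

    pot-∧ : ∀ B₀ e → pot B₀ _∧_ e ≡ pot B₀ B e ⊓ pot B₀ B′ e
    pot-∧ B₀ e = begin
      pot B₀ _∧_ e                           ≡⟨ pot-+ B₀ B _∧_ e ⟩
      h + pot B _∧_ e                        ≡⟨ cong (_+_ h) (trans (pot-meet e) (ℤ.⊓-comm (μ e) 0ℤ)) ⟩
      h + (0ℤ ⊓ μ e)                          ≡⟨ ℤ.mono-≤-distrib-⊓ (ℤ.+-monoʳ-≤ h) 0ℤ (μ e) ⟩
      (h + 0ℤ) ⊓ (h + μ e)                    ≡⟨ cong₂ _⊓_ (ℤ.+-identityʳ h) (sym (pot-+ B₀ B B′ e)) ⟩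
      h ⊓ pot B₀ B′ e                         ∎
      where h = pot B₀ B e

  -- The order and lattice laws are those of ℤ, read edge by edge through `pot`. No balanced
  -- 4-orientation is given in advance, so each law takes one of its own arguments as the base.
  isDistributiveLattice : IsDistributiveLattice _≈_ _≼_ _∨_ _∧_
  isDistributiveLattice = record
    { isLattice = record
      { isPartialOrder = record
        { isPreorder = record
          { isEquivalence = record
            { refl  = λ _ → refl
            ; sym   = λ B≈B′ d → sym (B≈B′ d)
            ; trans = λ B≈B′ B′≈B″ d → trans (B≈B′ d) (B′≈B″ d)
            }
          ; reflexive = λ {B} {B′} B≈B′ → ≤⇒≼ B B B′ (ℤ.≤-reflexive ∘ ≈⇒≡ B B B′ B≈B′)
          ; trans     = λ {B} {B′} {B″} B≼B′ B′≼B″ → ≤⇒≼ B B B″ λ e →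
              ℤ.≤-trans (≼⇒≤ B B B′ B≼B′ e) (≼⇒≤ B B′ B″ B′≼B″ e)
          }
        ; antisym = λ {B} {B′} B≼B′ B′≼B → ≡⇒≈ B B B′ λ e →
            ℤ.≤-antisym (≼⇒≤ B B B′ B≼B′ e) (≼⇒≤ B B′ B B′≼B e)
        }
      ; supremum = λ B B′ →
          (≤⇒≼ B B (B ∨ B′) λ e → subst (pot B B e ℤ.≤_) (sym (pot-∨ B B′ B e)) (ℤ.i≤i⊔j _ _)) ,
          (≤⇒≼ B B′ (B ∨ B′) λ e → subst (pot B B′ e ℤ.≤_) (sym (pot-∨ B B′ B e)) (ℤ.i≤j⊔i _ _)) ,
          λ B″ B≼B″ B′≼B″ → ≤⇒≼ B (B ∨ B′) B″ λ e → subst (ℤ._≤ pot B B″ e) (sym (pot-∨ B B′ B e))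
            (ℤ.⊔-lub (≼⇒≤ B B B″ B≼B″ e) (≼⇒≤ B B′ B″ B′≼B″ e))
      ; infimum = λ B B′ →
          (≤⇒≼ B (B ∧ B′) B λ e → subst (ℤ._≤ pot B B e) (sym (pot-∧ B B′ B e)) (ℤ.i⊓j≤i _ _)) ,
          (≤⇒≼ B (B ∧ B′) B′ λ e → subst (ℤ._≤ pot B B′ e) (sym (pot-∧ B B′ B e)) (ℤ.i⊓j≤j _ _)) ,
          λ B″ B″≼B B″≼B′ → ≤⇒≼ B B″ (B ∧ B′) λ e → subst (pot B B″ e ℤ.≤_) (sym (pot-∧ B B′ B e))
            (ℤ.⊓-glb (≼⇒≤ B B″ B B″≼B e) (≼⇒≤ B B″ B′ B″≼B′ e))
      }
    ; ∧-distribˡ-∨ = λ B B′ B″ → ≡⇒≈ B (B ∧ (B′ ∨ B″)) ((B ∧ B′) ∨ (B ∧ B″)) λ e → begin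
        pot B (B ∧ (B′ ∨ B″)) e
          ≡⟨ trans (pot-∧ B (B′ ∨ B″) B e) (cong (pot B B e ⊓_) (pot-∨ B′ B″ B e)) ⟩
        pot B B e ⊓ (pot B B′ e ⊔ pot B B″ e)
          ≡⟨ ℤ.⊓-distribˡ-⊔ (pot B B e) (pot B B′ e) (pot B B″ e) ⟩
        (pot B B e ⊓ pot B B′ e) ⊔ (pot B B e ⊓ pot B B″ e)
          ≡⟨ sym (trans (pot-∨ (B ∧ B′) (B ∧ B″) B e) (cong₂ _⊔_ (pot-∧ B B′ B e) (pot-∧ B B″ B e))) ⟩
        pot B ((B ∧ B′) ∨ (B ∧ B″)) e ∎
    }

theorem3 : (G : Map) → IsToroidalTriangulation G → EssentiallyFourConnected G →
    (R : Orientation (angleMap G)) (f₀ : Map.Face (angleMap G)) →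
    ∃₂ λ _∨_ _∧_ → IsDistributiveLattice (_≈ᴮ_ G) (BalancedBelow G R f₀) _∨_ _∧_
theorem3 G triangulation _ R f₀ = _∨_ , _∧_ , isDistributiveLattice
  where
  open IsToroidalTriangulation triangulation using (isToroidal)
  open BalancedLattice G (IsToroidal.connected isToroidal) R f₀
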